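{- Let $Q$ be a finite left automorphic Moufang loop, $S\le Q$, and $x,y\in Q$ such that $xS\cap yS\neq\emptyset$. Then $|xS\cap yS|=|T|$ for some subloop $T$ of $S$. In particular, $|xS\cap yS|$ divides $|S|$.
   Context: A Moufang loop is a loop satisfying $((xy)x)z=x(y(xz))$. A loop is left automorphic if every left inner mapping (element of the stabilizer of $1$ in the group generated by the left translations $L_x:y\mapsto xy$) is an automorphism. $xS=\{xs:s\in S\}$. -}

module Defs where

open import Algebra.Bundles using (Loop)
open import Algebra.Morphism.Structures using (IsLoopIsomorphism)
open import Data.Fin.Base using (Fin)
open import Data.Nat.Base using (ℕ)
open import Data.Product.Base using (∃; _×_; _,_)
open import Data.Vec.Base using (tabulate; count)
open import Function.Bundles using (Inverse)
open import Function.Construct.Composition using () renaming (inverse to _⨾_)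
open import Function.Construct.Identity using () renaming (inverse to identityₚ)
open import Function.Construct.Symmetry using () renaming (inverse to _⁻¹)
open import Level using (Level; suc; _⊔_)
open import Relation.Binary.Bundles using (Setoid)
open import Relation.Binary.Definitions using (_Respects_)
open import Relation.Binary.PropositionalEquality using () renaming (setoid to ≡-setoid)
open import Relation.Nullary.Decidable using (map′)
open import Relation.Unary using (Pred; Decidable)
import Relation.Unary as U
import Relation.Unary.Properties as U

module Finiteness {c ℓ : Level} (A : Setoid c ℓ) where
  open Setoid A using (Carrier; _≈_)

  record Finite : Set (c ⊔ ℓ) where
    field
      size        : ℕ
      enumeration : Inverse (≡-setoid (Fin size)) A

  -- Membership is decidable so that subsets of a finite set can be counted;
  -- classically this is no restriction.
  record Subset (p : Level) : Set (c ⊔ ℓ ⊔ suc p) where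
    field
      pred : Pred Carrier p
      resp : pred Respects _≈_
      dec  : Decidable pred

  open Subset

  _⊆_ : ∀ {p q : Level} → Subset p → Subset q → Set (c ⊔ p ⊔ q)
  P ⊆ R = pred P U.⊆ pred R

  Nonempty : ∀ {p : Level} → Subset p → Set (c ⊔ p)
  Nonempty P = U.Satisfiable (pred P)

  infixr 7 _∩_
  _∩_ : ∀ {p q : Level} → Subset p → Subset q → Subset (p ⊔ q)
  P ∩ R = record
    { pred = pred P U.∩ pred R
    ; resp = λ { x≈y (x∈P , x∈R) → resp P x≈y x∈P , resp R x≈y x∈R }
    ; dec  = dec P U.∩? dec R
    }

  -- The enumeration lists every element exactly once up to _≈_, so the count
  -- does not depend on which enumeration is used.
  card : Finite → ∀ {p : Level} → Subset p → ℕ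
  card fin P = count (dec P) (tabulate (Inverse.to (Finite.enumeration fin)))

module LoopTheory {c ℓ : Level} (Q : Loop c ℓ) where
  open Loop Q
  open Finiteness setoid public

  IsMoufang : Set (c ⊔ ℓ)
  IsMoufang = ∀ x y z → ((x ∙ y) ∙ x) ∙ z ≈ x ∙ (y ∙ (x ∙ z))

  L : Carrier → Inverse setoid setoid
  L x = record
    { to        = x ∙_
    ; from      = x \\_
    ; to-cong   = ∙-congˡ
    ; from-cong = \\-congˡ
    ; inverse   = (λ {y} eq → trans (∙-congˡ eq) (leftDividesˡ x y))
                , (λ {y} eq → trans (\\-congˡ eq) (leftDividesʳ x y))
    }

  -- Membership in the subgroup of Sym(Q) generated by the left translations;
  -- permutations are identified when they agree pointwise up to _≈_.
  data LMlt : Inverse setoid setoid → Set (c ⊔ ℓ) where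
    generator   : ∀ x → LMlt (L x)
    unit        : LMlt (identityₚ setoid)
    composition : ∀ {f g} → LMlt f → LMlt g → LMlt (f ⨾ g)
    inversion   : ∀ {f} → LMlt f → LMlt (f ⁻¹)
    respects    : ∀ {f g} → (∀ z → Inverse.to f z ≈ Inverse.to g z) → LMlt f → LMlt g

  IsLeftInner : Inverse setoid setoid → Set (c ⊔ ℓ)
  IsLeftInner f = LMlt f × Inverse.to f ε ≈ ε

  IsLeftAutomorphic : Set (c ⊔ ℓ)
  IsLeftAutomorphic = ∀ f → IsLeftInner f → IsLoopIsomorphism rawLoop rawLoop (Inverse.to f)

  record IsSubloop {p : Level} (S : Subset p) : Set (c ⊔ p) where
    open Subset S using (pred)
    field
      ε-closed  : pred ε
      ∙-closed  : ∀ {x y} → pred x → pred y → pred (x ∙ y)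
      \\-closed : ∀ {x y} → pred x → pred y → pred (x \\ y)
      //-closed : ∀ {x y} → pred x → pred y → pred (x // y)

  infixr 8 _⋆_
  _⋆_ : ∀ {p : Level} → Carrier → Subset p → Subset (c ⊔ ℓ ⊔ p)
  x ⋆ S = record
    { pred = λ z → ∃ λ s → Subset.pred S s × z ≈ x ∙ s
    ; resp = λ { z≈w (s , s∈S , z≈xs) → s , s∈S , trans (sym z≈w) z≈xs }
    ; dec  = λ z → map′
        (λ h → x \\ z , h , sym (leftDividesˡ x z))
        (λ { (s , s∈S , z≈xs) →
             Subset.resp S (sym (trans (\\-congˡ z≈xs) (leftDividesʳ x s))) s∈S })
        (Subset.dec S (x \\ z))
    }

{-# OPTIONS --safe #-}

-- Let z ∈ xS ∩ yS and write x = zu, y = zv with u, v ∈ S.  The left inner maps of z along u and v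
-- carry z⁻¹(xS) and z⁻¹(yS) onto S, so z⁻¹(xS ∩ yS) is the intersection of two automorphic images of
-- S, and one of the two maps carries it onto a subloop T of S that contains every nuclear element of S.
--
-- For the divisibility, left automorphy makes the quotient by the nucleus N a commutative Moufang
-- loop, in which cubes are central.  Modulo the preimage Z of its centre, S and T become Hall triple
-- systems (x • y = (x y)⁻¹), whose sizes are powers of 3, while the cosets of T ∩ Z partition S ∩ Z
-- because T contains S ∩ N.
--
-- That a finite Hall system has 3ᵏ points is a Baer–Suzuki argument: the translations are shown to act
-- unipotently on the functions to 𝔽₃.  An invariant functional then splits the system into three equal
-- fibres.  Existence statements are proved under double negation, as divisibility of naturals is decidable.
module Submission where

open import Algebra.Bundles using (Loop)
open import Algebra.Core using (Op₁; Op₂)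
open import Algebra.Morphism.Structures using (IsLoopIsomorphism)
import Algebra.Properties.Loop as LoopProperties
import Algebra.Properties.Quasigroup as QuasigroupProperties
open import Data.Empty using (⊥; ⊥-elim)
open import Data.Fin.Base using (Fin; zero; suc; toℕ; combine; remQuot)
open import Data.Fin.Patterns using (0F; 1F; 2F)
open import Data.Fin.Properties
  using (_≟_; ¬Fin0; all?; any?; injective⇒≤; suc-injective; remQuot-combine; combine-remQuot)
open import Data.Fin.Subset using (⁅_⁆; _⊃_)
  renaming (Subset to FinSubset; ⊥ to ∅ₛ; _∈_ to _∈ₛ_; _∉_ to _∉ₛ_; _⊆_ to _⊆ₛ_; _∪_ to _∪ₛ_; _∩_ to _∩ₛ_)
open import Data.Fin.Subset.Induction using (⊃-wellFounded)
open import Data.Fin.Subset.Properties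
  using (_∈?_; x∈p∩q⁺; x∈p∩q⁻; x∈p∪q⁺; x∈p∪q⁻; x∈⁅x⁆; x∈⁅y⁆⇒x≡y; ∉⊥; p⊆p∪q; q⊆p∪q)
open import Data.Nat.Base using (ℕ; NonZero; zero; suc; _+_; _*_; _∸_; _^_; _≤_; _<_; s≤s; z≤n)
open import Data.Nat.Divisibility using (_∣_; _∣?_; divides; *-pres-∣; m∣m*n; ∣-reflexive)
open import Data.Nat.DivMod using (_mod_)
open import Data.Nat.Induction using (<-wellFounded)
open import Data.Nat.Properties
  using (+-suc; +-comm; +-identityʳ; ≤-antisym; ≤-total; m<m+n; m+[n∸m]≡n; ^-distribˡ-+-*; ^-monoʳ-≤)
open import Data.Product.Base using (_×_; _,_; proj₁; proj₂; ∃; ∃₂)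
open import Data.Sum.Base as Sum using (_⊎_; inj₁; inj₂)
open import Data.Unit.Base using (⊤; tt)
open import Data.Vec.Base using (tabulate; count)
open import Function.Base using (_∘_; id)
open import Function.Bundles using (Inverse)
import Function.Construct.Composition as Composition
import Function.Construct.Symmetry as Symmetry
open import Induction.WellFounded using (Acc; acc)
open import Level using (Level; 0ℓ; _⊔_)
open import Relation.Binary.Bundles using (Setoid)
open import Relation.Binary.Core using (Rel)
open import Relation.Binary.Definitions using (Symmetric; Transitive)
open import Relation.Binary.PropositionalEquality as ≡ using (_≡_; _≢_; _≗_)
import Relation.Binary.Reasoning.Setoid as SetoidReasoning
open import Relation.Binary.Structures using (IsEquivalence)
open import Relation.Nullary.Decidable.Core
  using (Dec; yes; no; map′; ¬¬-excluded-middle; decidable-stable; from-yes; ¬?; _→-dec_; _×-dec_; _⊎-dec_)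
open import Relation.Nullary.Negation using (¬_; contradiction)
open import Relation.Unary as U using (Pred; _∈_; _∪_; ∅; Decidable)
open import Defs

-- Hall triple systems

-- Cosets of `T` in `S` may overlap without coinciding, as `S` is not associative, so they cannot
-- simply be counted. The centre of the quotient by the nucleus splits the difficulty. Below it,
-- associativity fails only by nuclear factors, which `T` absorbs. Above it, both sizes are powers
-- of the same prime, so the inequality coming from `T ⊆ S` already gives divisibility.
--
-- The hard point is the power of 3. Baer-Suzuki passes from all translations to two of them, hence
-- to four points. Taking one of the four as unit, the relevant structure is a commutative Moufang
-- loop of exponent 3 on three generators, and such a loop has class at most 2. The identities for
-- `θ` and `κ` express this law in a form that also controls how maps built from the four points act
-- on the rest of the system.
--
-- Nilpotency of the operators `δ g` stands in for being a 3-group: it passes to unions with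
-- normalising unipotent sets, turns commutators into gains of depth, and directly yields the
-- functional on which the induction on size rests.

record IsHallSystem {X : Set} (_•_ : Op₂ X) : Set where
  field
    •-comm    : ∀ x y → x • y ≡ y • x
    •-idem    : ∀ x → x • x ≡ x
    •-invol   : ∀ x y → x • (x • y) ≡ y
    •-distrib : ∀ x y z → x • (y • z) ≡ (x • y) • (x • z)

module HallSystem {X : Set} {_•_ : Op₂ X} (isHall : IsHallSystem _•_) where
  open IsHallSystem isHall public
  open ≡ using (sym; trans; cong; cong₂; module ≡-Reasoning)
  open ≡-Reasoning

  Homomorphic : (X → X) → Set
  Homomorphic g = ∀ x y → g (x • y) ≡ g x • g y

  ∘-homomorphic : ∀ {g h} → Homomorphic g → Homomorphic h → Homomorphic (g ∘ h)
  ∘-homomorphic {g} {h} g-hom h-hom x y =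
    trans (cong g (h-hom x y)) (g-hom (h x) (h y))

  -- The product of two reflections: in an affine space over 𝔽₃ the translation by `b - a`. In
  -- general it still carries `a` to `b`.
  τ : X → X → X → X
  τ a b s = a • (b • s)

  τ-homomorphic : ∀ a b → Homomorphic (τ a b)
  τ-homomorphic a b = ∘-homomorphic {a •_} {b •_} (•-distrib a) (•-distrib b)

  τ-conj : ∀ {g} → Homomorphic g → ∀ a b s → g (τ a b s) ≡ τ (g a) (g b) (g s)
  τ-conj {g} g-hom a b s = trans (g-hom a (b • s)) (cong (g a •_) (g-hom b s))

  τ-inverse : ∀ a b s → τ a b (τ b a s) ≡ s
  τ-inverse a b s = begin
    a • (b • (b • (a • s)))  ≡⟨ cong (a •_) (•-invol b (a • s)) ⟩
    a • (a • s)              ≡⟨ •-invol a s ⟩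
    s                        ∎

  •-involʳ : ∀ x y → (y • x) • x ≡ y
  •-involʳ x y = begin
    (y • x) • x  ≡⟨ •-comm (y • x) x ⟩
    x • (y • x)  ≡⟨ cong (x •_) (•-comm y x) ⟩
    x • (x • y)  ≡⟨ •-invol x y ⟩
    y            ∎

  τ-line : ∀ a b s → s • τ a b s ≡ τ b a s
  τ-line a b s = begin
    s • (a • (b • s))        ≡⟨ •-distrib s a (b • s) ⟩
    (s • a) • (s • (b • s))  ≡⟨ cong ((s • a) •_) (cong (s •_) (•-comm b s)) ⟩
    (s • a) • (s • (s • b))  ≡⟨ cong₂ _•_ (•-comm s a) (•-invol s b) ⟩
    (a • s) • b              ≡⟨ •-comm (a • s) b ⟩
    b • (a • s)              ∎

  τ-square : ∀ a b s → τ a b (τ a b s) ≡ τ b a s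
  τ-square a b s = begin
    a • (b • (a • (b • s)))        ≡⟨ cong (a •_) (•-distrib b a (b • s)) ⟩
    a • ((b • a) • (b • (b • s)))  ≡⟨ cong (a •_) (cong₂ _•_ (•-comm b a) (•-invol b s)) ⟩
    a • ((a • b) • s)              ≡⟨ •-distrib a (a • b) s ⟩
    (a • (a • b)) • (a • s)        ≡⟨ cong (_• (a • s)) (•-invol a b) ⟩
    b • (a • s)                    ∎

  Cube≗id : (X → X) → Set
  Cube≗id g = ∀ s → g (g (g s)) ≡ s

  τ-cube : ∀ a b → Cube≗id (τ a b)
  τ-cube a b s = trans (cong (τ a b) (τ-square a b s)) (τ-inverse a b s)

  ρ : X → X → X → X → X
  ρ a b c s = a • (b • (c • s))

  -- In an affine plane a product of three reflections is a reflection, so θ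
  -- measures how far the plane of a, b, c is from acting as an affine plane on X.
  θ : X → X → X → X → X
  θ a b c s = ρ a b c (ρ a b c s)

  ρ-homomorphic : ∀ a b c → Homomorphic (ρ a b c)
  ρ-homomorphic a b c = ∘-homomorphic {a •_} {τ b c} (•-distrib a) (τ-homomorphic b c)

  θ-homomorphic : ∀ a b c → Homomorphic (θ a b c)
  θ-homomorphic a b c =
    ∘-homomorphic {ρ a b c} {ρ a b c} (ρ-homomorphic a b c) (ρ-homomorphic a b c)

  θ-fix₁ : ∀ a b c → θ a b c a ≡ a
  θ-fix₁ a b c = begin
    a • (b • (c • (a • (b • (c • a)))))
      ≡⟨ cong (λ u → a • (b • (c • u))) (•-distrib a b (c • a)) ⟩
    a • (b • (c • ((a • b) • (a • (c • a)))))
      ≡⟨ cong (λ u → a • (b • (c • ((a • b) • (a • u))))) (•-comm c a) ⟩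
    a • (b • (c • ((a • b) • (a • (a • c)))))
      ≡⟨ cong (λ u → a • (b • (c • ((a • b) • u)))) (•-invol a c) ⟩
    a • (b • (c • ((a • b) • c)))
      ≡⟨ cong (λ u → a • (b • u)) (trans (•-comm c _) (•-involʳ c (a • b))) ⟩
    a • (b • (a • b))                                ≡⟨ cong (a •_) (trans (•-comm b _) (•-involʳ b a)) ⟩
    a • a                                            ≡⟨ •-idem a ⟩
    a                                                ∎

  θ-fix₂ : ∀ a b c → θ a b c b ≡ b
  θ-fix₂ a b c = begin
    a • (b • (c • (a • (b • (c • b)))))
      ≡⟨ cong (λ u → a • (b • (c • (a • u)))) (trans (•-comm b _) (•-involʳ b c)) ⟩
    a • (b • (c • (a • c)))              ≡⟨ cong (λ u → a • (b • u)) (trans (•-comm c _) (•-involʳ c a)) ⟩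
    a • (b • a)                          ≡⟨ trans (•-comm a _) (•-involʳ a b) ⟩
    b                                    ∎

  θ-fix₃ : ∀ a b c → θ a b c c ≡ c
  θ-fix₃ a b c = begin
    a • (b • (c • (a • (b • (c • c)))))  ≡⟨ cong (λ u → a • (b • (c • (a • (b • u))))) (•-idem c) ⟩
    a • (b • (c • (a • (b • c))))        ≡⟨ cong (λ u → a • (b • u)) (•-distrib c a (b • c)) ⟩
    a • (b • ((c • a) • (c • (b • c))))
      ≡⟨ cong (λ u → a • (b • ((c • a) • u))) (trans (•-comm c _) (•-involʳ c b)) ⟩
    a • (b • ((c • a) • b))              ≡⟨ cong (a •_) (trans (•-comm b _) (•-involʳ b (c • a))) ⟩
    a • (c • a)                          ≡⟨ trans (•-comm a _) (•-involʳ a c) ⟩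
    c                                    ∎

  commutes-• : ∀ {g} → Homomorphic g → ∀ {a} → g a ≡ a → ∀ s → g (a • s) ≡ a • g s
  commutes-• {g} g-hom {a} ga≡a s = trans (g-hom a s) (cong (_• g s) ga≡a)

  commutes-τ : ∀ {g} → Homomorphic g → ∀ {a b} → g a ≡ a → g b ≡ b →
               ∀ s → g (τ a b s) ≡ τ a b (g s)
  commutes-τ {g} g-hom {a} {b} ga≡a gb≡b s =
    trans (τ-conj g-hom a b s) (cong₂ (λ u v → τ u v (g s)) ga≡a gb≡b)

  θ-τ : ∀ a b c s → θ a b c (τ a b s) ≡ τ a b (θ a b c s)
  θ-τ a b c = commutes-τ (θ-homomorphic a b c) (θ-fix₁ a b c) (θ-fix₂ a b c)

  θ-cycle : ∀ a b c s → θ b c a s ≡ θ a b c s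
  θ-cycle a b c s = begin
    θ b c a s                ≡⟨ •-invol a _ ⟨
    a • (a • θ b c a s)      ≡⟨⟩
    a • (θ a b c (a • s))    ≡⟨ cong (a •_) (commutes-• (θ-homomorphic a b c) (θ-fix₁ a b c) s) ⟩
    a • (a • θ a b c s)      ≡⟨ •-invol a _ ⟩
    θ a b c s                ∎

  ρ-reverse : ∀ a b c s → ρ c b a (ρ a b c s) ≡ s
  ρ-reverse a b c s = begin
    c • (b • (a • (a • (b • (c • s)))))  ≡⟨ cong (λ u → c • (b • u)) (•-invol a _) ⟩
    c • (b • (b • (c • s)))              ≡⟨ cong (c •_) (•-invol b _) ⟩
    c • (c • s)                          ≡⟨ •-invol c s ⟩
    s                                    ∎

  θ-reverse : ∀ a b c s → θ c b a (θ a b c s) ≡ s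
  θ-reverse a b c s = trans (cong (ρ c b a) (ρ-reverse a b c (ρ a b c s))) (ρ-reverse a b c s)

  -- `θ a b c` is the composite of `τ a b` with its conjugate `σ′` by the reflection in `c`. It
  -- commutes with `τ a b`, so the two factors commute, and each has cube 1.
  θ-cube : ∀ a b c → Cube≗id (θ a b c)
  θ-cube a b c s = begin
    t (t (t s))                                  ≡⟨ cong t (cong t (τ-cube a b (t s))) ⟨
    t (t (σ (σ (σ (t s)))))                      ≡⟨ cong t (comm³ (t s)) ⟩
    t (σ (σ (σ (t (t s)))))                      ≡⟨ cong (λ u → t (σ (σ (σ u)))) (cong t (τ-cube a b (t s))) ⟨
    t (σ (σ (σ (t (σ (σ (σ (t s))))))))          ≡⟨ step ⟩
    σ′ (σ′ (σ′ s))                               ≡⟨ σ′-cube s ⟩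
    s                                            ∎
    where
    t σ σ′ : X → X
    t = θ a b c
    σ = τ a b
    σ′ u = c • σ (c • u)
    comm³ : ∀ u → t (σ (σ (σ u))) ≡ σ (σ (σ (t u)))
    comm³ u = trans (θ-τ a b c _) (cong σ (trans (θ-τ a b c _) (cong σ (θ-τ a b c u))))
    σ′-expand : ∀ u → σ′ u ≡ σ (σ (t u))
    σ′-expand u = begin
      c • σ (c • u)                  ≡⟨ τ-cube a b _ ⟨
      σ (σ (σ (c • σ (c • u))))      ≡⟨⟩
      σ (σ (t u))                    ∎
    σ′-cube : ∀ u → σ′ (σ′ (σ′ u)) ≡ u
    σ′-cube u = begin
      c • σ (c • (c • σ (c • (c • σ (c • u)))))  ≡⟨ cong (λ v → c • σ v) (•-invol c _) ⟩
      c • σ (σ (c • (c • σ (c • u))))            ≡⟨ cong (λ v → c • σ (σ v)) (•-invol c _) ⟩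
      c • σ (σ (σ (c • u)))                      ≡⟨ cong (c •_) (τ-cube a b _) ⟩
      c • (c • u)                                ≡⟨ •-invol c u ⟩
      u                                          ∎
    step : t (σ (σ (σ (t (σ (σ (σ (t s)))))))) ≡ σ′ (σ′ (σ′ s))
    step = begin
      t (σ (σ (σ (t (σ (σ (σ (t s))))))))        ≡⟨ θ-τ a b c _ ⟩
      σ (t (σ (σ (t (σ (σ (σ (t s))))))))        ≡⟨ cong σ (θ-τ a b c _) ⟩
      σ (σ (t (σ (t (σ (σ (σ (t s))))))))        ≡⟨ cong (λ v → σ (σ (t (σ v)))) (θ-τ a b c _) ⟩
      σ (σ (t (σ (σ (t (σ (σ (t s))))))))        ≡⟨ cong (λ v → σ (σ (t (σ (σ (t v)))))) (σ′-expand s) ⟨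
      σ (σ (t (σ (σ (t (σ′ s))))))               ≡⟨ cong (λ v → σ (σ (t v))) (σ′-expand (σ′ s)) ⟨
      σ (σ (t (σ′ (σ′ s))))                      ≡⟨ σ′-expand _ ⟨
      σ′ (σ′ (σ′ s))                             ∎

  -- The hypothesis amounts to `σ (c • d) ≡ c • σ⁻ d`; as the orbit of `c • d` under `σ` is a line,
  -- the same equation follows with `c` and `d` exchanged. Together with `θ-cycle-fix` and
  -- `θ-reverse-fix` this makes `θ a b c d ≡ d` symmetric in its four points.
  θ-exchange : ∀ a b c d → θ a b c d ≡ d → θ a b d c ≡ c
  θ-exchange a b c d fixed = begin
    σ (d • σ (d • c))          ≡⟨ cong (λ u → σ (d • u)) σ-dc ⟩
    σ (d • (d • σ⁻ c))         ≡⟨ cong σ (•-invol d _) ⟩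
    σ (σ⁻ c)                   ≡⟨ τ-inverse a b c ⟩
    c                          ∎
    where
    σ σ⁻ : X → X
    σ = τ a b
    σ⁻ = τ b a
    σ-cd : σ (c • d) ≡ c • σ⁻ d
    σ-cd = begin
      σ (c • d)                  ≡⟨ •-invol c _ ⟨
      c • (c • σ (c • d))        ≡⟨ cong (c •_) (τ-inverse b a _) ⟨
      c • σ⁻ (θ a b c d)         ≡⟨ cong (λ u → c • σ⁻ u) fixed ⟩
      c • σ⁻ d                   ∎
    σ⁻-cd : σ⁻ (c • d) ≡ σ c • d
    σ⁻-cd = begin
      σ⁻ (c • d)         ≡⟨ τ-square a b _ ⟨
      σ (σ (c • d))      ≡⟨ cong σ σ-cd ⟩
      σ (c • σ⁻ d)       ≡⟨ τ-homomorphic a b c _ ⟩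
      σ c • σ (σ⁻ d)     ≡⟨ cong (σ c •_) (τ-inverse a b d) ⟩
      σ c • d            ∎
    σ-dc : σ (d • c) ≡ d • σ⁻ c
    σ-dc = begin
      σ (d • c)                ≡⟨ cong σ (•-comm d c) ⟩
      σ (c • d)                ≡⟨ τ-line b a _ ⟨
      (c • d) • σ⁻ (c • d)     ≡⟨ cong₂ _•_ (•-comm c d) (trans σ⁻-cd (•-comm _ d)) ⟩
      (d • c) • (d • σ c)      ≡⟨ •-distrib d c (σ c) ⟨
      d • (c • σ c)            ≡⟨ cong (d •_) (τ-line a b c) ⟩
      d • σ⁻ c                 ∎

  -- In an affine space a translation is determined by one image; here `θ a b c` is the discrepancy
  -- between two translations that move `c` alike. Consequently `θ a b c ∘ τ a b` is itself a
  -- translation and its orbits are lines.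
  θτ-translation : ∀ a b c s → τ c (τ a b c) s ≡ θ a b c (τ a b s)
  θτ-translation a b c s = begin
    c • (σ c • s)              ≡⟨ cong (λ u → c • (σ c • u)) (τ-inverse a b s) ⟨
    c • (σ c • σ (σ⁻ s))       ≡⟨ cong (c •_) (τ-homomorphic a b c _) ⟨
    c • σ (c • σ⁻ s)           ≡⟨ τ-inverse b a _ ⟨
    σ⁻ (σ (c • σ (c • σ⁻ s)))  ≡⟨⟩
    σ⁻ (θ a b c (σ⁻ s))        ≡⟨ commutes-τ (θ-homomorphic a b c) (θ-fix₂ a b c) (θ-fix₁ a b c) _ ⟨
    θ a b c (σ⁻ (σ⁻ s))        ≡⟨ cong (θ a b c) (τ-square b a s) ⟩
    θ a b c (σ s)              ∎
    where
    σ σ⁻ : X → X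
    σ = τ a b
    σ⁻ = τ b a

  -- `θ a b (a • c)` is the conjugate by the reflection in `a` of `θ c b a`, the inverse of
  -- `θ a b c`, and `θ a b c` commutes with that reflection because it fixes `a`.
  θ-reflect : ∀ a b c s → θ a b (a • c) (θ a b c s) ≡ s
  θ-reflect a b c s = begin
    θ a b (a • c) (θ a b c s)             ≡⟨ expand _ ⟩
    a • θ c b a (a • θ a b c s)
      ≡⟨ cong (λ u → a • θ c b a u) (commutes-• (θ-homomorphic a b c) (θ-fix₁ a b c) s) ⟨
    a • θ c b a (θ a b c (a • s))         ≡⟨ cong (a •_) (θ-reverse a b c _) ⟩
    a • (a • s)                           ≡⟨ •-invol a s ⟩
    s                                     ∎
    where
    half : ∀ u → ρ a b (a • c) u ≡ a • (b • (a • (c • (a • u))))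
    half u = cong (λ v → a • (b • v)) (begin
      (a • c) • u                ≡⟨ cong ((a • c) •_) (•-invol a u) ⟨
      (a • c) • (a • (a • u))    ≡⟨ •-distrib a c (a • u) ⟨
      a • (c • (a • u))          ∎)
    expand : ∀ u → θ a b (a • c) u ≡ a • θ c b a (a • u)
    expand u = begin
      θ a b (a • c) u
        ≡⟨ trans (half _) (cong (λ v → a • (b • (a • (c • (a • v))))) (half u)) ⟩
      a • (b • (a • (c • (a • (a • (b • (a • (c • (a • u)))))))))
        ≡⟨ cong (λ v → a • (b • (a • (c • v)))) (•-invol a _) ⟩
      a • (b • (a • (c • (b • (a • (c • (a • u)))))))                        ≡⟨⟩
      a • θ b a c (a • u)
        ≡⟨ cong (a •_) (θ-cycle c b a (a • u)) ⟩
      a • θ c b a (a • u)                                                    ∎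

  τ-line² : ∀ a b s → s • τ a b s ≡ τ a b (τ a b s)
  τ-line² a b s = trans (τ-line a b s) (sym (τ-square a b s))

  module Lines (a b c : X) where
    σ t : X → X
    σ = τ a b
    t = θ a b c

    tσ : ∀ s → t (σ s) ≡ σ (t s)
    tσ = θ-τ a b c

    private
      line-of : ∀ {g} → (∃₂ λ p q → τ p q ≗ g) → ∀ s → s • g s ≡ g (g s)
      line-of {g} (p , q , τ≗g) s = begin
        s • g s          ≡⟨ cong (s •_) (τ≗g s) ⟨
        s • τ p q s      ≡⟨ τ-line² p q s ⟩
        τ p q (τ p q s)  ≡⟨ τ≗g _ ⟩
        g (τ p q s)      ≡⟨ cong g (τ≗g s) ⟩
        g (g s)          ∎

    line₁ : ∀ s → s • t (σ s) ≡ t (t (σ (σ s)))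
    line₁ s = trans (line-of (c , σ c , θτ-translation a b c) s) (cong t (sym (tσ (σ s))))

    -- Reflecting c in a reverses the orientation of the plane, hence inverts θ.
    line₂ : ∀ s → s • t (t (σ s)) ≡ t (σ (σ s))
    line₂ s = begin
      s • t (t (σ s))            ≡⟨ line-of (a • c , σ (a • c) , translation) s ⟩
      t (t (σ (t (t (σ s)))))    ≡⟨ cong (λ u → t (t u)) (trans (cong t (tσ _)) (tσ _)) ⟨
      t (t (t (t (σ (σ s)))))    ≡⟨ cong t (θ-cube a b c _) ⟩
      t (σ (σ s))                ∎
      where
      translation : τ (a • c) (σ (a • c)) ≗ t ∘ t ∘ σ
      translation u = begin
        τ (a • c) (σ (a • c)) u              ≡⟨ θτ-translation a b (a • c) u ⟩
        θ a b (a • c) (σ u)                  ≡⟨ cong (θ a b (a • c)) (θ-cube a b c _) ⟨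
        θ a b (a • c) (t (t (t (σ u))))      ≡⟨ θ-reflect a b c _ ⟩
        t (t (σ u))                          ∎

    -- The points σ^i t^j s form a 3 × 3 array, three of whose directions are known to consist of lines.
    θ-line : ∀ s → s • t s ≡ t (t s)
    θ-line s = begin
      p                          ≡⟨ τ-inverse b a p ⟨
      τ b a (σ p)                ≡⟨ τ-square a b _ ⟨
      σ (σ (σ p))                ≡⟨ cong σ σσp ⟩
      σ (t (t (σ (σ s))))        ≡⟨ trans (cong t (tσ _)) (tσ _) ⟨
      t (t (σ (σ (σ s))))        ≡⟨ cong (λ u → t (t u)) (τ-cube a b s) ⟩
      t (t s)                    ∎
      where
      p z₂₂ : X
      p = s • t s
      z₂₂ = t (t (σ (σ s)))
      s-line : s ≡ z₂₂ • t (σ s)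
      s-line = begin
        s                                    ≡⟨ τ-cube a b s ⟨
        σ (σ (σ s))                          ≡⟨ θ-cube a b c _ ⟨
        t (t (t (σ (σ (σ s)))))              ≡⟨ cong (λ u → t (t u)) (trans (tσ _) (cong σ (tσ _))) ⟩
        t (t (σ (σ (t (σ s)))))              ≡⟨ line₁ (t (σ s)) ⟨
        t (σ s) • t (σ (t (σ s)))            ≡⟨ cong (λ u → t (σ s) • t u) (tσ (σ s)) ⟨
        t (σ s) • z₂₂                        ≡⟨ •-comm _ z₂₂ ⟩
        z₂₂ • t (σ s)                        ∎
      ts-line : t s ≡ z₂₂ • σ s
      ts-line = begin
        t s                          ≡⟨ cong t (τ-cube a b s) ⟨
        t (σ (σ (σ s)))              ≡⟨ line₂ (σ s) ⟨
        σ s • t (t (σ (σ s)))        ≡⟨ •-comm (σ s) z₂₂ ⟩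
        z₂₂ • σ s                    ∎
      p-line : p ≡ z₂₂ • σ p
      p-line = begin
        s • t s                          ≡⟨ cong₂ _•_ s-line ts-line ⟩
        (z₂₂ • t (σ s)) • (z₂₂ • σ s)    ≡⟨ •-distrib z₂₂ _ _ ⟨
        z₂₂ • (t (σ s) • σ s)            ≡⟨ cong (z₂₂ •_) (trans (•-comm _ _) (cong (σ s •_) (tσ s))) ⟩
        z₂₂ • (σ s • σ (t s))            ≡⟨ cong (z₂₂ •_) (τ-homomorphic a b s _) ⟨
        z₂₂ • σ p                        ∎
      σσp : σ (σ p) ≡ z₂₂
      σσp = begin
        σ (σ p)                ≡⟨ τ-line² a b p ⟨
        p • σ p                ≡⟨ cong (_• σ p) p-line ⟩
        (z₂₂ • σ p) • σ p      ≡⟨ •-involʳ (σ p) z₂₂ ⟩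
        z₂₂                    ∎

    -- The source of the nontrivial fixed points of `κ`: for `w = θ a b c d` it gives
    -- `θ a b d w ≡ w`, and the symmetry of this relation brings it into the positions required.
    -- `θ-line` and `line₂` collapse the product to `t σ³`.
    θ-fix-image : ∀ s → θ a b s (t s) ≡ t s
    θ-fix-image s = begin
      σ (s • σ (s • t s))            ≡⟨ cong (λ u → σ (s • σ u)) (θ-line s) ⟩
      σ (s • σ (t (t s)))            ≡⟨ cong (λ u → σ (s • u)) (trans (cong t (tσ s)) (tσ _)) ⟨
      σ (s • t (t (σ s)))            ≡⟨ cong σ (line₂ s) ⟩
      σ (t (σ (σ s)))                ≡⟨ tσ _ ⟨
      t (σ (σ (σ s)))                ≡⟨ cong t (τ-cube a b s) ⟩
      t s                            ∎

  θ-reverse-fix : ∀ a b c d → θ a b c d ≡ d → θ c b a d ≡ d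
  θ-reverse-fix a b c d fixed = trans (cong (θ c b a) (sym fixed)) (θ-reverse a b c d)

  θ-cycle-fix : ∀ a b c d → θ a b c d ≡ d → θ b c a d ≡ d
  θ-cycle-fix a b c d fixed = trans (θ-cycle a b c d) fixed

  -- With `w = θ a b c d` and `r = τ w d` this is the conjugate of `r` by the reflection in `u`,
  -- times `r`: it measures how far that reflection is from inverting `r`.
  κ : X → X → X → X → X → X → X
  κ u a b c d = θ u (θ a b c d) d

  κ-fix₂ : ∀ a b c d → κ a a b c d b ≡ b
  κ-fix₂ a b c d =
    θ-cycle-fix d a w b (θ-exchange d a b w (θ-cycle-fix b d a w (θ-cycle-fix a b d w
      (Lines.θ-fix-image a b c d))))
    where w = θ a b c d

  κ-fix₁ : ∀ a b c d → κ b a b c d a ≡ a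
  κ-fix₁ a b c d =
    θ-reverse-fix d w b a (θ-cycle-fix b d w a (θ-exchange b d a w (θ-cycle-fix a b d w
      (Lines.θ-fix-image a b c d))))
    where w = θ a b c d

  κ-cycle : ∀ u a b c d → κ u a b c d ≗ κ u b c a d
  κ-cycle u a b c d s = cong (λ w → θ u w d s) (sym (θ-cycle a b c d))

  κ-homomorphic : ∀ u a b c d → Homomorphic (κ u a b c d)
  κ-homomorphic u a b c d = θ-homomorphic u (θ a b c d) d

  data In₃ (a b c : X) : X → Set where
    fst : In₃ a b c a
    snd : In₃ a b c b
    trd : In₃ a b c c

  -- With `κ-fix₄` all four points are fixed, so this automorphism commutes with the four
  -- reflections: the class-two law.
  κ-fix : ∀ {a b c u v} d → In₃ a b c u → In₃ a b c v → κ u a b c d v ≡ v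
  κ-fix {a} {b} {c} d fst fst = θ-fix₁ a (θ a b c d) d
  κ-fix {a} {b} {c} d fst snd = κ-fix₂ a b c d
  κ-fix {a} {b} {c} d fst trd =
    trans (trans (κ-cycle a a b c d c) (κ-cycle a b c a d c)) (κ-fix₁ c a b d)
  κ-fix {a} {b} {c} d snd fst = κ-fix₁ a b c d
  κ-fix {a} {b} {c} d snd snd = θ-fix₁ b (θ a b c d) d
  κ-fix {a} {b} {c} d snd trd = trans (κ-cycle b a b c d c) (κ-fix₂ b c a d)
  κ-fix {a} {b} {c} d trd fst =
    trans (trans (κ-cycle c a b c d a) (κ-cycle c b c a d a)) (κ-fix₂ c a b d)
  κ-fix {a} {b} {c} d trd snd = trans (κ-cycle c a b c d b) (κ-fix₁ b c a d)
  κ-fix {a} {b} {c} d trd trd = θ-fix₁ c (θ a b c d) d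

  κ-fix₄ : ∀ u a b c d → κ u a b c d d ≡ d
  κ-fix₄ u a b c d = θ-fix₃ u (θ a b c d) d

-- Unipotent actions on functions to 𝔽₃

infixl 6 _⊖_
-- Subtraction, with 2 in place of -1. It is the only operation used; a sum is written
-- `a ⊖ (0F ⊖ b)`.
_⊖_ : Fin 3 → Fin 3 → Fin 3
a ⊖ b = (toℕ a + 2 * toℕ b) mod 3

private
  multiple : Fin 3 → Fin 3 → Fin 3
  multiple d zero                = 0F
  multiple d (suc zero)          = d
  multiple d (suc (suc zero))    = d ⊖ (0F ⊖ d)

private abstract
  n⊖n : ∀ a → a ⊖ a ≡ 0F
  n⊖n = from-yes (all? λ a → a ⊖ a ≟ 0F)

  n⊖0 : ∀ a → a ⊖ 0F ≡ a
  n⊖0 = from-yes (all? λ a → a ⊖ 0F ≟ a)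

  ⊖-interchange : ∀ a b c d → (a ⊖ b) ⊖ (c ⊖ d) ≡ (a ⊖ c) ⊖ (b ⊖ d)
  ⊖-interchange = from-yes (all? λ a → all? λ b → all? λ c → all? λ d →
    (a ⊖ b) ⊖ (c ⊖ d) ≟ (a ⊖ c) ⊖ (b ⊖ d))

  ⊖-cancel : ∀ a b → a ⊖ (a ⊖ b) ≡ b
  ⊖-cancel = from-yes (all? λ a → all? λ b → a ⊖ (a ⊖ b) ≟ b)

  ⊖-compose : ∀ a b c → (a ⊖ b) ⊖ (0F ⊖ (b ⊖ c)) ≡ a ⊖ c
  ⊖-compose = from-yes (all? λ a → all? λ b → all? λ c → (a ⊖ b) ⊖ (0F ⊖ (b ⊖ c)) ≟ a ⊖ c)

  ⊖-cube : ∀ a b c → ((a ⊖ c) ⊖ (c ⊖ b)) ⊖ ((c ⊖ b) ⊖ (b ⊖ a)) ≡ 0F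
  ⊖-cube = from-yes (all? λ a → all? λ b → all? λ c →
    ((a ⊖ c) ⊖ (c ⊖ b)) ⊖ ((c ⊖ b) ⊖ (b ⊖ a)) ≟ 0F)

  ⊖-commutator : ∀ a b c d e → ((a ⊖ b) ⊖ (c ⊖ d)) ⊖ ((e ⊖ c) ⊖ (b ⊖ d)) ≡ a ⊖ e
  ⊖-commutator = from-yes (all? λ a → all? λ b → all? λ c → all? λ d → all? λ e →
    ((a ⊖ b) ⊖ (c ⊖ d)) ⊖ ((e ⊖ c) ⊖ (b ⊖ d)) ≟ a ⊖ e)

  ⊖-flip : ∀ a b → 0F ⊖ (a ⊖ b) ≡ b ⊖ a
  ⊖-flip = from-yes (all? λ a → all? λ b → 0F ⊖ (a ⊖ b) ≟ b ⊖ a)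

  increment : ∀ a b d → a ⊖ b ≡ d → a ≡ d ⊖ (0F ⊖ b)
  increment = from-yes (all? λ a → all? λ b → all? λ d → (a ⊖ b ≟ d) →-dec (a ≟ d ⊖ (0F ⊖ b)))

  midpoint : ∀ p c → p ⊖ c ≡ c ⊖ p → p ≡ c
  midpoint = from-yes (all? λ p → all? λ c → (p ⊖ c ≟ c ⊖ p) →-dec (p ≟ c))

  reaches-zero : ∀ d a → d ≢ 0F → a ≡ 0F ⊎ d ⊖ (0F ⊖ a) ≡ 0F ⊎ d ⊖ (0F ⊖ (d ⊖ (0F ⊖ a))) ≡ 0F
  reaches-zero = from-yes (all? λ d → all? λ a →
    ¬? (d ≟ 0F) →-dec ((a ≟ 0F) ⊎-dec ((d ⊖ (0F ⊖ a) ≟ 0F) ⊎-dec (d ⊖ (0F ⊖ (d ⊖ (0F ⊖ a))) ≟ 0F))))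

  ⊖≡0⇒≡ : ∀ a b → a ⊖ b ≡ 0F → a ≡ b
  ⊖≡0⇒≡ = from-yes (all? λ a → all? λ b → (a ⊖ b ≟ 0F) →-dec (a ≟ b))

  multiple-injective : ∀ d i j → d ≢ 0F → multiple d i ≡ multiple d j → i ≡ j
  multiple-injective = from-yes (all? λ d → all? λ i → all? λ j →
    ¬? (d ≟ 0F) →-dec ((multiple d i ≟ multiple d j) →-dec (i ≟ j)))

module Unipotent (X : Set) where
  open U using (_⊆_)
  open ≡ using (refl; sym; trans; cong; cong₂; subst)

  V : Set
  V = X → Fin 3

  Maps : Set₁
  Maps = Pred (X → X) 0ℓ

  δ : (X → X) → V → V
  δ g v s = v (g s) ⊖ v s

  infixl 6 _⊖ᵥ_
  _⊖ᵥ_ : V → V → V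
  (u ⊖ᵥ v) s = u s ⊖ v s

  Zero : Pred V 0ℓ
  Zero v = ∀ s → v s ≡ 0F

  -- Each `step` applies one operator `δ g`. The target `B` is kept variable so that `Nil-∪` can
  -- filter a layer belonging to one set of maps by another set.
  data L (Γ : Maps) (B : Pred V 0ℓ) : ℕ → Pred V 0ℓ where
    base : ∀ {v} → v ∈ B → L Γ B zero v
    step : ∀ {i v} → (∀ {g} → g ∈ Γ → L Γ B i (δ g v)) → L Γ B (suc i) v

  K : Maps → ℕ → Pred V 0ℓ
  K Γ = L Γ Zero

  -- Unipotence of the generated group, with a uniform length. For permutations of a finite set this
  -- amounts to generating a 3-group.
  Nil : Maps → Set
  Nil Γ = ∃ λ r → ∀ v → v ∈ K Γ r

  apply : ∀ {Γ B i v g} → v ∈ L Γ B (suc i) → g ∈ Γ → δ g v ∈ L Γ B i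
  apply (step v∈) = v∈

  L-base : ∀ {Γ B B′} → B ⊆ B′ → ∀ {i} → L Γ B i ⊆ L Γ B′ i
  L-base B⊆B′ (base v∈) = base (B⊆B′ v∈)
  L-base B⊆B′ (step v∈) = step λ g∈ → L-base B⊆B′ (v∈ g∈)

  module _ {Γ : Maps} where

    K-resp : ∀ {i u v} → u ≗ v → u ∈ K Γ i → v ∈ K Γ i
    K-resp u≗v (base u∈) = base λ s → trans (sym (u≗v s)) (u∈ s)
    K-resp u≗v (step u∈) = step λ {g} g∈ →
      K-resp (λ s → cong₂ _⊖_ (u≗v (g s)) (u≗v s)) (u∈ g∈)

    K-⊖ : ∀ {i u v} → u ∈ K Γ i → v ∈ K Γ i → u ⊖ᵥ v ∈ K Γ i
    K-⊖ (base u∈) (base v∈) = base λ s → cong₂ _⊖_ (u∈ s) (v∈ s)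
    K-⊖ {u = u} {v} (step u∈) (step v∈) = step λ {g} g∈ →
      K-resp (λ s → ⊖-interchange (u (g s)) (u s) (v (g s)) (v s)) (K-⊖ (u∈ g∈) (v∈ g∈))

    K-zero : ∀ i → (λ _ → 0F) ∈ K Γ i
    K-zero zero    = base λ s → refl
    K-zero (suc i) = step λ g∈ → K-zero i

    K-weaken : ∀ {i} → K Γ i ⊆ K Γ (suc i)
    K-weaken (base v∈) = step λ {g} g∈ → base λ s → cong₂ _⊖_ (v∈ (g s)) (v∈ s)
    K-weaken (step v∈) = step λ g∈ → K-weaken (v∈ g∈)

  Preserves : Maps → Maps
  Preserves Γ g = ∀ i {v} → v ∈ K Γ i → v ∘ g ∈ K Γ i

  -- Depth `k`: the operator `g - 1` descends `k` levels at once. Depths play the part of a central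
  -- series.
  Lowers : Maps → ℕ → Maps
  Lowers Γ k g = ∀ i {v} → v ∈ K Γ (k + i) → δ g v ∈ K Γ i

  module _ {Γ : Maps} where

    Preserves-∘ : ∀ {g h} → g ∈ Preserves Γ → h ∈ Preserves Γ → g ∘ h ∈ Preserves Γ
    Preserves-∘ g∈ h∈ i v∈ = h∈ i (g∈ i v∈)

    Preserves-resp : ∀ {g h} → g ≗ h → g ∈ Preserves Γ → h ∈ Preserves Γ
    Preserves-resp g≗h g∈ i {v} v∈ = K-resp (λ s → cong v (g≗h s)) (g∈ i v∈)

    Lowers⇒Preserves : ∀ {g} → g ∈ Lowers Γ 1 → g ∈ Preserves Γ
    Lowers⇒Preserves {g} g∈ zero    (base v∈) = base λ s → v∈ (g s)
    Lowers⇒Preserves {g} g∈ (suc i) {v} v∈ =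
      K-resp (λ s → trans (cong (v s ⊖_) (⊖-flip (v (g s)) (v s))) (⊖-cancel (v s) (v (g s))))
        (K-⊖ v∈ (K-weaken (K-⊖ (K-zero i) (g∈ i v∈))))

    Lowers-resp : ∀ k {g h} → g ≗ h → g ∈ Lowers Γ k → h ∈ Lowers Γ k
    Lowers-resp k g≗h g∈ i {v} v∈ = K-resp (λ s → cong (λ u → v u ⊖ v s) (g≗h s)) (g∈ i v∈)

    Lowers-∘ : ∀ {g h} → g ∈ Lowers Γ 1 → h ∈ Lowers Γ 1 → g ∘ h ∈ Lowers Γ 1
    Lowers-∘ {g} {h} g∈ h∈ i {v} v∈ =
      K-resp (λ s → ⊖-compose (v (g (h s))) (v (h s)) (v s))
        (K-⊖ (Lowers⇒Preserves h∈ i (g∈ i v∈)) (K-⊖ (K-zero i) (h∈ i v∈)))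

    Lowers-conj : ∀ k {g h h⁻} → g ∈ Lowers Γ k → h ∈ Preserves Γ → h⁻ ∈ Preserves Γ →
                  (∀ s → h (h⁻ s) ≡ s) → h ∘ g ∘ h⁻ ∈ Lowers Γ k
    Lowers-conj k {g} {h} {h⁻} g∈ h∈ h⁻∈ inv i {v} v∈ =
      K-resp (λ s → cong (λ u → v (h (g (h⁻ s))) ⊖ v u) (inv s)) (h⁻∈ i (g∈ i (h∈ (k + i) v∈)))

    private
      commutator : ∀ {i} v a b a⁻ b⁻ → (∀ s → a⁻ (a s) ≡ s) → (∀ s → b (b⁻ s) ≡ s) →
                   b⁻ ∈ Preserves Γ →
                   δ a (δ b (v ∘ a⁻)) ∈ K Γ i → δ b (δ a (v ∘ a⁻)) ∈ K Γ i →
                   δ (a⁻ ∘ b ∘ a ∘ b⁻) v ∈ K Γ i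
      commutator {i} v a b a⁻ b⁻ a⁻a bb⁻ b⁻∈ ab∈ ba∈ =
        K-resp (λ s → trans
            (⊖-commutator (v (a⁻ (b (a (b⁻ s))))) (v (a⁻ (a (b⁻ s)))) (v (a⁻ (b (b⁻ s))))
              (v (a⁻ (b⁻ s))) (v (a⁻ (a (b (b⁻ s))))))
            (cong (λ u → v (a⁻ (b (a (b⁻ s)))) ⊖ v u) (trans (a⁻a _) (bb⁻ s))))
          (b⁻∈ i (K-⊖ ab∈ ba∈))

      lower-then : ∀ k {i a b v} → a ∈ Lowers Γ 1 → b ∈ Lowers Γ k →
                   v ∈ K Γ (suc k + i) → δ a (δ b v) ∈ K Γ i
      lower-then k {i} {v = v} a∈ b∈ v∈ =
        a∈ i (b∈ (suc i) (subst (λ j → v ∈ K Γ j) (sym (+-suc k i)) v∈))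

      then-lower : ∀ k {i a b v} → a ∈ Lowers Γ 1 → b ∈ Lowers Γ k →
                   v ∈ K Γ (suc k + i) → δ b (δ a v) ∈ K Γ i
      then-lower k {i} a∈ b∈ v∈ = b∈ i (a∈ (k + i) v∈)

    -- Depths add, since `ab - ba = (a - 1)(b - 1) - (b - 1)(a - 1)`, and the group commutator minus
    -- 1 is this difference up to maps preserving the filtration.
    Lowers-commutatorˡ : ∀ k {a b a⁻ b⁻} → (∀ s → a⁻ (a s) ≡ s) → (∀ s → b (b⁻ s) ≡ s) →
      a ∈ Lowers Γ 1 → b ∈ Lowers Γ k → a⁻ ∈ Preserves Γ → b⁻ ∈ Preserves Γ →
      a⁻ ∘ b ∘ a ∘ b⁻ ∈ Lowers Γ (suc k)
    Lowers-commutatorˡ k {a} {b} {a⁻} {b⁻} a⁻a bb⁻ a∈ b∈ a⁻∈ b⁻∈ i {v} v∈ =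
      commutator v a b a⁻ b⁻ a⁻a bb⁻ b⁻∈
        (lower-then k a∈ b∈ (a⁻∈ (suc k + i) v∈)) (then-lower k a∈ b∈ (a⁻∈ (suc k + i) v∈))

    Lowers-commutatorʳ : ∀ k {a b a⁻ b⁻} → (∀ s → a⁻ (a s) ≡ s) → (∀ s → b (b⁻ s) ≡ s) →
      a ∈ Lowers Γ k → b ∈ Lowers Γ 1 → a⁻ ∈ Preserves Γ → b⁻ ∈ Preserves Γ →
      a⁻ ∘ b ∘ a ∘ b⁻ ∈ Lowers Γ (suc k)
    Lowers-commutatorʳ k {a} {b} {a⁻} {b⁻} a⁻a bb⁻ a∈ b∈ a⁻∈ b⁻∈ i {v} v∈ =
      commutator v a b a⁻ b⁻ a⁻a bb⁻ b⁻∈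
        (then-lower k b∈ a∈ (a⁻∈ (suc k + i) v∈)) (lower-then k b∈ a∈ (a⁻∈ (suc k + i) v∈))

  -- `δ g (v ∘ h)` equals `δ g′ v` composed with `h`, so invariance of one level follows from
  -- invariance of the level below.
  Preserves-normaliser : ∀ {Γ h} → (∀ {g} → g ∈ Γ → ∃ λ g′ → g′ ∈ Lowers Γ 1 × h ∘ g ≗ g′ ∘ h) →
                         h ∈ Preserves Γ
  Preserves-normaliser {h = h} norm zero    (base v∈) = base λ s → v∈ (h s)
  Preserves-normaliser {Γ} {h} norm (suc i) {v} v∈ = step λ g∈ → conj (norm g∈)
    where
    conj : ∀ {g} → ∃ (λ g′ → g′ ∈ Lowers Γ 1 × h ∘ g ≗ g′ ∘ h) → δ g (v ∘ h) ∈ K Γ i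
    conj (g′ , g′∈ , hg≗g′h) = K-resp (λ s → cong (λ u → v u ⊖ v (h s)) (sym (hg≗g′h s)))
      (Preserves-normaliser norm i (g′∈ i v∈))

  K-antitone : ∀ {Γ Γ′} → (∀ {g} → g ∈ Γ′ → g ∈ Lowers Γ 1) → ∀ i → K Γ i ⊆ K Γ′ i
  K-antitone Γ′⊆ zero    (base v∈) = base v∈
  K-antitone Γ′⊆ (suc i) v∈ = step λ g∈ → K-antitone Γ′⊆ i (Γ′⊆ g∈ i v∈)

  Nil-antitone : ∀ {Γ Γ′} → (∀ {g} → g ∈ Γ′ → g ∈ Lowers Γ 1) → Nil Γ → Nil Γ′
  Nil-antitone Γ′⊆ (r , all) = r , λ v → K-antitone Γ′⊆ r (all v)

  ⊆-Lowers : ∀ {Γ g} → g ∈ Γ → g ∈ Lowers Γ 1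
  ⊆-Lowers g∈ i v∈ = apply v∈ g∈

  Nil-∅ : Nil ∅
  Nil-∅ = 1 , λ v → step λ ()

  -- In characteristic 3, `(g - 1)³ = g³ - 1`.
  Nil-cube : ∀ {g} → (∀ s → g (g (g s)) ≡ s) → Nil (_≡ g)
  Nil-cube {g} cube = 3 , λ v → step λ { refl → step λ { refl → step λ { refl → base λ s →
    trans (cong (λ u → ((v u ⊖ v (g (g s))) ⊖ (v (g (g s)) ⊖ v (g s))) ⊖
                       ((v (g (g s)) ⊖ v (g s)) ⊖ (v (g s) ⊖ v s))) (cube s))
          (⊖-cube (v s) (v (g s)) (v (g (g s)))) }}}

  -- On a layer of the filtration by `E` the maps of `E` act as the identity, so only `Γ` moves
  -- anything there and exhausts the layer in `q` steps; there are `r` layers.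
  Nil-∪ : ∀ {E Γ} → (∀ {g} → g ∈ Γ → g ∈ Preserves E) → Nil E → Nil Γ → Nil (E ∪ Γ)
  Nil-∪ {E} {Γ} Γ⊆ (r , allE) (q , allΓ) = r * q , λ v → climb r (allE v)
    where
    zero⊆ : ∀ i → Zero ⊆ K E i
    zero⊆ i v∈ = K-resp (λ s → sym (v∈ s)) (K-zero i)
    weaken : ∀ {a} j → K (E ∪ Γ) a ⊆ K (E ∪ Γ) (j + a)
    weaken zero    u∈ = u∈
    weaken (suc j) u∈ = K-weaken (weaken j u∈)
    refine : ∀ {i a} → K E i ⊆ K (E ∪ Γ) a → ∀ j {v} →
             v ∈ K E (suc i) → v ∈ L Γ (K E i) j → v ∈ K (E ∪ Γ) (j + a)
    refine inc zero v∈ (base v∈′) = inc v∈′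
    refine {i} {a} inc (suc j) {v} v∈ v∈′ = step λ
      { (inj₁ g∈) → weaken j (inc (apply v∈ g∈))
      ; (inj₂ g∈) → refine inc j (K-⊖ (Γ⊆ g∈ (suc i) v∈) v∈) (apply v∈′ g∈) }
    climb : ∀ i → K E i ⊆ K (E ∪ Γ) (i * q)
    climb zero    (base v∈) = base v∈
    climb (suc i) {v} v∈ = refine (climb i) q v∈ (L-base (zero⊆ i) (allΓ v))

-- Unipotence of two translations

module TwoTranslations {X : Set} {_•_ : Op₂ X} (isHall : IsHallSystem _•_) where
  open HallSystem isHall
  open Unipotent X
  open ≡ using (refl; sym; trans; cong; module ≡-Reasoning)
  open ≡-Reasoning
  open U using (_⊆_)

  -- Composition suffices: the maps adjoined below have cube 1, so their inverses are squares.
  data Gen (E : Maps) : Maps where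
    gen   : ∀ {g} → g ∈ E → g ∈ Gen E
    comp  : ∀ {g h} → g ∈ Gen E → h ∈ Gen E → g ∘ h ∈ Gen E
    gresp : ∀ {g h} → g ≗ h → g ∈ Gen E → h ∈ Gen E

  Gen-mono : ∀ {E E′} → E ⊆ E′ → Gen E ⊆ Gen E′
  Gen-mono E⊆E′ (gen g∈)       = gen (E⊆E′ g∈)
  Gen-mono E⊆E′ (comp g∈ h∈)   = comp (Gen-mono E⊆E′ g∈) (Gen-mono E⊆E′ h∈)
  Gen-mono E⊆E′ (gresp g≗h g∈) = gresp g≗h (Gen-mono E⊆E′ g∈)

  Gen⇒Lowers : ∀ {E g} → g ∈ Gen E → g ∈ Lowers E 1
  Gen⇒Lowers (gen g∈)       = ⊆-Lowers g∈
  Gen⇒Lowers (comp g∈ h∈)   = Lowers-∘ (Gen⇒Lowers g∈) (Gen⇒Lowers h∈)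
  Gen⇒Lowers (gresp g≗h g∈) = Lowers-resp 1 g≗h (Gen⇒Lowers g∈)

  module _ (P : Pred X 0ℓ) where

    Word : Maps
    Word = Gen (λ g → ∃ λ u → u ∈ P × g ≡ (u •_))

    Conjugates : Maps → (X → X) → Set
    Conjugates E g = ∀ {u} → u ∈ P → ∃ λ g′ → g′ ∈ Gen E × (u •_) ∘ g ≗ g′ ∘ (u •_)

    -- One step of an ascending normal series: what `E` generates is unipotent and normalised by the
    -- reflections in `P`, which is the invariant that lets `extend` adjoin a further map.
    record Stage (E : Maps) : Set where
      field
        nil    : Nil E
        normal : ∀ {g} → g ∈ E → Conjugates E g

    open Stage

    Conjugates-mono : ∀ {E E′} → E ⊆ E′ → Conjugates E ⊆ Conjugates E′
    Conjugates-mono E⊆E′ conj u∈ =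
      let g′ , g′∈ , eq = conj u∈ in g′ , Gen-mono E⊆E′ g′∈ , eq

    stage-∅ : Stage ∅
    stage-∅ .nil = Nil-∅
    stage-∅ .normal ()

    Word⇒Preserves : ∀ {E g} → Stage E → g ∈ Word → g ∈ Preserves E
    Word⇒Preserves stage (gen (u , u∈ , refl)) = Preserves-normaliser λ g∈ →
      let g′ , g′∈ , eq = normal stage g∈ u∈ in g′ , Gen⇒Lowers g′∈ , eq
    Word⇒Preserves stage (comp g∈ h∈) =
      Preserves-∘ (Word⇒Preserves stage g∈) (Word⇒Preserves stage h∈)
    Word⇒Preserves stage (gresp g≗h g∈) = Preserves-resp g≗h (Word⇒Preserves stage g∈)

    extend : ∀ {E g} → Stage E → g ∈ Word → Cube≗id g → Conjugates (E ∪ (_≡ g)) g →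
             Stage (E ∪ (_≡ g))
    extend stage g∈ cube conj .nil =
      Nil-∪ (λ { refl → Word⇒Preserves stage g∈ }) (nil stage) (Nil-cube cube)
    extend stage g∈ cube conj .normal (inj₁ h∈)   = Conjugates-mono inj₁ (normal stage h∈)
    extend stage g∈ cube conj .normal (inj₂ refl) = conj

    •-word : ∀ {u} → u ∈ P → (u •_) ∈ Word
    •-word u∈ = gen (_ , u∈ , refl)

    τ-word : ∀ {a b} → (a •_) ∈ Word → (b •_) ∈ Word → τ a b ∈ Word
    τ-word = comp

    θ-word : ∀ {a b c} → (a •_) ∈ Word → (b •_) ∈ Word → (c •_) ∈ Word → θ a b c ∈ Word
    θ-word a∈ b∈ c∈ = comp (comp a∈ (comp b∈ c∈)) (comp a∈ (comp b∈ c∈))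

    τ⁻¹-gen : ∀ {E a b} → τ a b ∈ Gen E → τ b a ∈ Gen E
    τ⁻¹-gen {a = a} {b} τ∈ = gresp (τ-square a b) (comp τ∈ τ∈)

    -- The reflections in `a` and `b` invert `σ`, and any other reflection, in `u`, conjugates it to
    -- `σ² θ a b u`. Hence the maps `θ a b u` have to be present before `σ` is adjoined.
    add-τ : ∀ {E a b} → a ∈ P → b ∈ P → (∀ {u} → u ∈ P → u ≡ a ⊎ u ≡ b ⊎ θ a b u ∈ Gen E) →
            Stage E → Stage (E ∪ (_≡ τ a b))
    add-τ {E} {a} {b} a∈ b∈ others stage =
      extend stage (τ-word (•-word a∈) (•-word b∈)) (τ-cube a b) (λ u∈ → conj (others u∈))
      where
      σ : X → X
      σ = τ a b
      E′ : Maps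
      E′ = E ∪ (_≡ σ)
      σ∈ : σ ∈ Gen E′
      σ∈ = gen (inj₂ refl)
      conj : ∀ {u} → u ≡ a ⊎ u ≡ b ⊎ θ a b u ∈ Gen E →
             ∃ λ g′ → g′ ∈ Gen E′ × (u •_) ∘ σ ≗ g′ ∘ (u •_)
      conj (inj₁ refl) = τ b a , τ⁻¹-gen σ∈ ,
        λ s → trans (•-invol a (b • s)) (cong (b •_) (sym (•-invol a s)))
      conj (inj₂ (inj₁ refl)) = τ b a , τ⁻¹-gen σ∈ , λ s → refl
      conj {u} (inj₂ (inj₂ θ∈)) =
        σ ∘ σ ∘ θ a b u , comp σ∈ (comp σ∈ (Gen-mono inj₁ θ∈)) , λ s → begin
          u • σ s                                    ≡⟨ τ-cube a b _ ⟨
          σ (σ (σ (u • σ s)))                        ≡⟨ cong (λ v → σ (σ (σ (u • σ v)))) (•-invol u s) ⟨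
          σ (σ (σ (u • σ (u • (u • s)))))            ≡⟨⟩
          σ (σ (θ a b u (u • s)))                    ∎

    -- The order of adjunction is forced by conjugation: the reflection in `d` takes `t` to `r⁻¹ t`,
    -- a reflection in a point `u` among `a`, `b`, `c` takes `r` to `k u` times `r²`, and `k u`
    -- commutes with all of them.
    module Plane {a b c d : X} (a∈ : a ∈ P) (b∈ : b ∈ P) (c∈ : c ∈ P) (d∈ : d ∈ P)
                 (cover : ∀ {u} → u ∈ P → In₃ a b c u ⊎ u ≡ d) where
      w : X
      w = θ a b c d

      t r : X → X
      t = θ a b c
      r = τ w d

      t-word : t ∈ Word
      t-word = θ-word (•-word a∈) (•-word b∈) (•-word c∈)

      -- The reflection in `w = t d` is the conjugate by `t` of the reflection in `d`, with `t ∘ t`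
      -- as inverse of `t`.
      w-word : (w •_) ∈ Word
      w-word = gresp (λ s → trans (θ-homomorphic a b c d _) (cong (w •_) (θ-cube a b c s)))
                     (comp t-word (comp (•-word d∈) (comp t-word t-word)))

      k : X → X → X
      k u = κ u a b c d

      k-central : ∀ {u v} → In₃ a b c u → v ∈ P → ∀ s → v • k u s ≡ k u (v • s)
      k-central {u} u∈ v∈ s = sym (commutes-• (κ-homomorphic u a b c d) (fixed (cover v∈)) s)
        where
        fixed : ∀ {v} → In₃ a b c v ⊎ v ≡ d → k u v ≡ v
        fixed (inj₁ v∈)   = κ-fix d u∈ v∈
        fixed (inj₂ refl) = κ-fix₄ u a b c d

      add-k : ∀ {E u} → u ∈ P → In₃ a b c u → Stage E → Stage (E ∪ (_≡ k u))
      add-k {E} {u} u∈P u∈ stage = extend stage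
        (θ-word (•-word u∈P) w-word (•-word d∈)) (θ-cube u w d)
        (λ v∈ → k u , gen (inj₂ refl) , k-central u∈ v∈)

      module _ (E : Maps) where
        E₁ E₂ E₃ : Maps
        E₁ = ((E ∪ (_≡ k a)) ∪ (_≡ k b)) ∪ (_≡ k c)
        E₂ = E₁ ∪ (_≡ r)
        E₃ = E₂ ∪ (_≡ t)

        k∈ : ∀ {u} → In₃ a b c u → k u ∈ E₁
        k∈ fst = inj₁ (inj₁ (inj₂ refl))
        k∈ snd = inj₁ (inj₂ refl)
        k∈ trd = inj₂ refl

        r∈ : r ∈ Gen E₂
        r∈ = gen (inj₂ refl)

        r-conj : Conjugates E₂ r
        r-conj u∈ = conj (cover u∈)
          where
          conj : ∀ {u} → In₃ a b c u ⊎ u ≡ d → ∃ λ g′ → g′ ∈ Gen E₂ × (u •_) ∘ r ≗ g′ ∘ (u •_)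
          conj {u} (inj₁ u∈) =
            k u ∘ r ∘ r , comp (gen (inj₁ (k∈ u∈))) (comp r∈ r∈) , λ s → begin
              u • r s                                  ≡⟨ cong (λ v → u • r v) (•-invol u s) ⟨
              u • r (u • (u • s))                      ≡⟨ cong (λ v → u • r (u • v)) (τ-cube w d (u • s)) ⟨
              u • r (u • r (r (r (u • s))))            ≡⟨⟩
              k u (r (r (u • s)))                      ∎
          conj (inj₂ refl) = τ d w , τ⁻¹-gen r∈ , λ s → refl

        t-conj : Conjugates E₃ t
        t-conj u∈ = conj (cover u∈)
          where
          central : ∀ {u} → t u ≡ u → ∃ λ g′ → g′ ∈ Gen E₃ × (u •_) ∘ t ≗ g′ ∘ (u •_)
          central tu≡u =
            t , gen (inj₂ refl) , λ s → sym (commutes-• (θ-homomorphic a b c) tu≡u s)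
          conj : ∀ {u} → In₃ a b c u ⊎ u ≡ d → ∃ λ g′ → g′ ∈ Gen E₃ × (u •_) ∘ t ≗ g′ ∘ (u •_)
          conj (inj₁ fst) = central (θ-fix₁ a b c)
          conj (inj₁ snd) = central (θ-fix₂ a b c)
          conj (inj₁ trd) = central (θ-fix₃ a b c)
          conj (inj₂ refl) =
            τ d w ∘ t , comp (Gen-mono inj₁ (τ⁻¹-gen r∈)) (gen (inj₂ refl)) , λ s → begin
              d • t s                    ≡⟨ cong (d •_) (•-invol w _) ⟨
              d • (w • (w • t s))        ≡⟨ cong (τ d w) (θ-homomorphic a b c d s) ⟨
              d • (w • t (d • s))        ∎

        E⊆E₃ : E ⊆ E₃
        E⊆E₃ g∈ = inj₁ (inj₁ (inj₁ (inj₁ (inj₁ g∈))))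

        t∈E₃ : t ∈ E₃
        t∈E₃ = inj₂ refl

        add-plane : Stage E → Stage E₃
        add-plane stage =
          extend (extend (add-k c∈ trd (add-k b∈ snd (add-k a∈ fst stage)))
                         (τ-word w-word (•-word d∈)) (τ-cube w d) r-conj)
                 t-word (θ-cube a b c) t-conj

  -- For each plane through three of the four points adjoin the κ's, which are central, then the
  -- translation τ w d and then θ; modulo these every reflection inverts the two given translations.
  Nil-two : ∀ a b p q → Nil (λ g → g ≡ τ a b ⊎ g ≡ τ p q)
  Nil-two o x y z = Nil-antitone (λ { (inj₁ refl) → ⊆-Lowers (inj₁ (inj₂ refl))
                                    ; (inj₂ refl) → ⊆-Lowers (inj₂ refl) })
                                 (Stage.nil stage₆)
    where
    data Four : Pred X 0ℓ where
      o! : Four o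
      x! : Four x
      y! : Four y
      z! : Four z
    cover₁ : ∀ {u} → u ∈ Four → In₃ o x y u ⊎ u ≡ z
    cover₁ o! = inj₁ fst
    cover₁ x! = inj₁ snd
    cover₁ y! = inj₁ trd
    cover₁ z! = inj₂ refl
    cover₂ : ∀ {u} → u ∈ Four → In₃ o x z u ⊎ u ≡ y
    cover₂ o! = inj₁ fst
    cover₂ x! = inj₁ snd
    cover₂ y! = inj₂ refl
    cover₂ z! = inj₁ trd
    cover₃ : ∀ {u} → u ∈ Four → In₃ y z o u ⊎ u ≡ x
    cover₃ o! = inj₁ trd
    cover₃ x! = inj₂ refl
    cover₃ y! = inj₁ fst
    cover₃ z! = inj₁ snd
    cover₄ : ∀ {u} → u ∈ Four → In₃ y z x u ⊎ u ≡ o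
    cover₄ o! = inj₂ refl
    cover₄ x! = inj₁ trd
    cover₄ y! = inj₁ fst
    cover₄ z! = inj₁ snd
    -- The triples are ordered so that `θ o x y`, `θ o x z`, `θ y z o` and `θ y z x` occur literally
    -- in the form that adjoining `τ o x` and `τ y z` asks for.
    module P₁ = Plane Four o! x! y! z! cover₁
    module P₂ = Plane Four o! x! z! y! cover₂
    module P₃ = Plane Four y! z! o! x! cover₃
    module P₄ = Plane Four y! z! x! o! cover₄
    E₁ E₂ E₃ E₄ E₅ E₆ : Maps
    E₁ = P₁.E₃ ∅
    E₂ = P₂.E₃ E₁
    E₃ = P₃.E₃ E₂
    E₄ = P₄.E₃ E₃
    E₅ = E₄ ∪ (_≡ τ o x)
    E₆ = E₅ ∪ (_≡ τ y z)
    stage₄ : Stage Four E₄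
    stage₄ = P₄.add-plane E₃ (P₃.add-plane E₂ (P₂.add-plane E₁ (P₁.add-plane ∅ (stage-∅ Four))))
    oxy : θ o x y ∈ E₄
    oxy = P₄.E⊆E₃ E₃ (P₃.E⊆E₃ E₂ (P₂.E⊆E₃ E₁ (P₁.t∈E₃ ∅)))
    oxz : θ o x z ∈ E₄
    oxz = P₄.E⊆E₃ E₃ (P₃.E⊆E₃ E₂ (P₂.t∈E₃ E₁))
    yzo : θ y z o ∈ E₅
    yzo = inj₁ (P₄.E⊆E₃ E₃ (P₃.t∈E₃ E₂))
    yzx : θ y z x ∈ E₅
    yzx = inj₁ (P₄.t∈E₃ E₃)
    stage₅ : Stage Four E₅
    stage₅ = add-τ Four o! x! (λ { o! → inj₁ refl ; x! → inj₂ (inj₁ refl)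
                                 ; y! → inj₂ (inj₂ (gen oxy)) ; z! → inj₂ (inj₂ (gen oxz)) }) stage₄
    stage₆ : Stage Four E₆
    stage₆ = add-τ Four y! z! (λ { o! → inj₂ (inj₂ (gen yzo)) ; x! → inj₂ (inj₂ (gen yzx))
                                 ; y! → inj₁ refl ; z! → inj₂ (inj₁ refl) }) stage₅

-- The Baer–Suzuki argument

module BaerSuzuki {n : ℕ} {_•_ : Op₂ (Fin n)} (isHall : IsHallSystem _•_) where
  open HallSystem isHall
  open Unipotent (Fin n)
  open TwoTranslations isHall using (Nil-two)
  open ≡ using (refl; sym; trans; cong; cong₂; subst; module ≡-Reasoning)

  X : Set
  X = Fin n

  -- A translation is named by a pair of points, so that sets of translations become finite subsets
  -- with decidable membership and well-founded inclusion. Several names for one map do no harm.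
  Index : Set
  Index = Fin (n * n)

  Indices : Set
  Indices = FinSubset (n * n)

  src tgt : Index → X
  src i = proj₁ (remQuot n i)
  tgt i = proj₂ (remQuot {n} n i)

  tr tr⁻ : Index → X → X
  tr i = τ (src i) (tgt i)
  tr⁻ i = τ (tgt i) (src i)

  infixr 6 _▷_
  -- Conjugation on names: for an automorphism `g`, conjugating `tr i` by `g` gives `tr (g ▷ i)`.
  _▷_ : (X → X) → Index → Index
  g ▷ i = combine (g (src i)) (g (tgt i))

  tr-combine : ∀ a b → tr (combine a b) ≡ τ a b
  tr-combine a b = cong (λ { (u , v) → τ u v }) (remQuot-combine a b)

  tr-▷ : ∀ {g} → Homomorphic g → ∀ i s → g (tr i s) ≡ tr (g ▷ i) (g s)
  tr-▷ {g} g-hom i s =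
    trans (τ-conj g-hom (src i) (tgt i) s) (cong (λ h → h (g s)) (sym (tr-combine _ _)))

  ▷-cong : ∀ {g h} → g ≗ h → ∀ i → g ▷ i ≡ h ▷ i
  ▷-cong g≗h i = cong₂ combine (g≗h (src i)) (g≗h (tgt i))

  ▷-∘ : ∀ g h i → (g ∘ h) ▷ i ≡ g ▷ h ▷ i
  ▷-∘ g h i = cong (λ { (u , v) → combine (g u) (g v) }) (sym (remQuot-combine (h (src i)) (h (tgt i))))

  ▷-id : ∀ {g} → g ≗ id → ∀ i → g ▷ i ≡ i
  ▷-id g≗id i = trans (▷-cong g≗id i) (combine-remQuot {n} n i)

  Translations : Indices → Maps
  Translations M g = ∃ λ i → i ∈ₛ M × g ≡ tr i

  record Maximal (M : Indices) : Set where
    field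
      nil     : Nil (Translations M)
      maximal : ∀ i → Nil (Translations M ∪ (_≡ tr i)) → i ∈ₛ M

  open Maximal

  Normalises : Indices → (X → X) → Set
  Normalises E g = ∀ i → i ∈ₛ E → (g ▷ i) ∈ₛ E

  -- Adjoin translations while the set stays unipotent; finiteness stops the process. Whether it can
  -- still grow is settled only under double negation, as `Nil` comes without a decision procedure.
  maximal-above : ∀ M → Nil (Translations M) → ¬ ¬ (∃ λ M′ → Maximal M′ × M ⊆ₛ M′)
  maximal-above M = go M (⊃-wellFounded M)
    where
    Grows : Indices → Set
    Grows M = ∃ λ i → i ∉ₛ M × Nil (Translations M ∪ (_≡ tr i))
    go : ∀ M → Acc _⊃_ M → Nil (Translations M) → ¬ ¬ (∃ λ M′ → Maximal M′ × M ⊆ₛ M′)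
    go M (acc rec) M-nil k = ¬¬-excluded-middle split
      where
      split : ¬ Dec (Grows M)
      split (yes (i , i∉M , nil′)) =
        go (M ∪ₛ ⁅ i ⁆) (rec (p⊆p∪q ⁅ i ⁆ , i , x∈p∪q⁺ (inj₂ (x∈⁅x⁆ i)) , i∉M))
          (Nil-antitone (λ { (j , j∈ , refl) → ⊆-Lowers (Sum.map
              (λ j∈M → j , j∈M , refl) (λ j∈i → cong tr (x∈⁅y⁆⇒x≡y i j∈i)) (x∈p∪q⁻ M ⁅ i ⁆ j∈)) }) nil′)
          λ { (M′ , M′-max , M⁺⊆M′) → k (M′ , M′-max , λ x∈ → M⁺⊆M′ (p⊆p∪q ⁅ i ⁆ x∈)) }
      split (no stuck) = k (M , record
        { nil = M-nil
        ; maximal = λ i nil′ → decidable-stable (i ∈? M) (λ i∉M → stuck (i , i∉M , nil′)) } , id)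

  module _ {M : Indices} (M-max : Maximal M) where

    -- A translation that already has depth 1 for `M` can be adjoined without changing the
    -- filtration.
    saturated : ∀ i → tr i ∈ Lowers (Translations M) 1 → i ∈ₛ M
    saturated i i∈ = maximal M-max i
      (Nil-antitone (λ { (inj₁ g∈) → ⊆-Lowers g∈ ; (inj₂ refl) → i∈ }) (nil M-max))

    tr-Lowers : ∀ {i} → i ∈ₛ M → tr i ∈ Lowers (Translations M) 1
    tr-Lowers i∈M = ⊆-Lowers (_ , i∈M , refl)

    tr⁻-Lowers : ∀ {i} → i ∈ₛ M → tr⁻ i ∈ Lowers (Translations M) 1
    tr⁻-Lowers {i} i∈M = Lowers-resp 1 (τ-square (src i) (tgt i)) (Lowers-∘ (tr-Lowers i∈M) (tr-Lowers i∈M))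

    conj-closed : ∀ {g g⁻} → Homomorphic g → (∀ s → g (g⁻ s) ≡ s) →
                  g ∈ Preserves (Translations M) → g⁻ ∈ Preserves (Translations M) →
                  ∀ {i} → i ∈ₛ M → (g ▷ i) ∈ₛ M
    conj-closed {g} {g⁻} g-hom gg⁻ g∈ g⁻∈ {i} i∈M = saturated (g ▷ i)
      (Lowers-resp 1 (λ s → trans (tr-▷ g-hom i (g⁻ s)) (cong (tr (g ▷ i)) (gg⁻ s)))
        (Lowers-conj 1 (tr-Lowers i∈M) g∈ g⁻∈ gg⁻))

    self-normal : ∀ {e i} → e ∈ₛ M → i ∈ₛ M → (tr e ▷ i) ∈ₛ M
    self-normal {e} e∈M = conj-closed (τ-homomorphic (src e) (tgt e)) (τ-inverse (src e) (tgt e))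
      (Lowers⇒Preserves (tr-Lowers e∈M)) (Lowers⇒Preserves (tr⁻-Lowers e∈M))

    record Aut (k : ℕ) (g g⁻ : X → X) : Set where
      field
        hom        : Homomorphic g
        inverseˡ   : ∀ s → g (g⁻ s) ≡ s
        inverseʳ   : ∀ s → g⁻ (g s) ≡ s
        lowers     : g ∈ Lowers (Translations M) k
        lowers⁻    : g⁻ ∈ Lowers (Translations M) k
        preserves  : g ∈ Preserves (Translations M)
        preserves⁻ : g⁻ ∈ Preserves (Translations M)

    tr-Aut : ∀ {i} → i ∈ₛ M → Aut 1 (tr i) (tr⁻ i)
    tr-Aut {i} i∈M = record
      { hom        = τ-homomorphic (src i) (tgt i)
      ; inverseˡ   = τ-inverse (src i) (tgt i)
      ; inverseʳ   = τ-inverse (tgt i) (src i)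
      ; lowers     = tr-Lowers i∈M
      ; lowers⁻    = tr⁻-Lowers i∈M
      ; preserves  = Lowers⇒Preserves (tr-Lowers i∈M)
      ; preserves⁻ = Lowers⇒Preserves (tr⁻-Lowers i∈M)
      }

    commutator-Aut : ∀ {k i g g⁻} → i ∈ₛ M → Aut k g g⁻ →
                     Aut (suc k) (tr⁻ i ∘ g ∘ tr i ∘ g⁻) (g ∘ tr⁻ i ∘ g⁻ ∘ tr i)
    commutator-Aut {k} {i} {g} {g⁻} i∈M G = record
      { hom        = λ x y → begin
          e⁻ (g (e (g⁻ (x • y))))         ≡⟨ cong (e⁻ ∘ g ∘ e) (g⁻-hom x y) ⟩
          e⁻ (g (e (g⁻ x • g⁻ y)))        ≡⟨ cong (e⁻ ∘ g) (T.hom _ _) ⟩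
          e⁻ (g (e (g⁻ x) • e (g⁻ y)))    ≡⟨ cong e⁻ (hom _ _) ⟩
          e⁻ (g (e (g⁻ x)) • g (e (g⁻ y)))  ≡⟨ τ-homomorphic (tgt i) (src i) _ _ ⟩
          e⁻ (g (e (g⁻ x))) • e⁻ (g (e (g⁻ y)))  ∎
      ; inverseˡ   = λ s → trans (cong (e⁻ ∘ g ∘ e) (inverseʳ _)) (trans (cong (e⁻ ∘ g) (T.inverseˡ _))
                       (trans (cong e⁻ (inverseˡ _)) (T.inverseʳ s)))
      ; inverseʳ   = λ s → trans (cong (g ∘ e⁻ ∘ g⁻) (T.inverseˡ _)) (trans (cong (g ∘ e⁻) (inverseʳ _))
                       (trans (cong g (T.inverseʳ _)) (inverseˡ s)))
      ; lowers     = Lowers-commutatorˡ k T.inverseʳ inverseˡ T.lowers lowers T.preserves⁻ preserves⁻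
      ; lowers⁻    = Lowers-commutatorʳ k inverseˡ T.inverseʳ lowers⁻ T.lowers⁻ preserves T.preserves
      ; preserves  = Preserves-∘ T.preserves⁻ (Preserves-∘ preserves (Preserves-∘ T.preserves preserves⁻))
      ; preserves⁻ = Preserves-∘ preserves (Preserves-∘ T.preserves⁻ (Preserves-∘ preserves⁻ T.preserves))
      }
      where
      open ≡-Reasoning
      open Aut G
      module T = Aut (tr-Aut i∈M)
      e e⁻ : X → X
      e = tr i
      e⁻ = tr⁻ i
      g⁻-hom : Homomorphic g⁻
      g⁻-hom x y = begin
        g⁻ (x • y)                    ≡⟨ cong₂ (λ u v → g⁻ (u • v)) (inverseˡ x) (inverseˡ y) ⟨
        g⁻ (g (g⁻ x) • g (g⁻ y))      ≡⟨ cong g⁻ (hom (g⁻ x) (g⁻ y)) ⟨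
        g⁻ (g (g⁻ x • g⁻ y))          ≡⟨ inverseʳ _ ⟩
        g⁻ x • g⁻ y                   ∎

    module _ {E : Indices} (E⊆M : E ⊆ₛ M)
             (E-normal : ∀ {e i} → e ∈ₛ E → i ∈ₛ E → (tr e ▷ i) ∈ₛ E) where

      -- If g moves e ∈ E out of E then g e g⁻¹ = e [e⁻¹ , g] and the commutator, being one step
      -- deeper in the central filtration, normalises E; so g e g⁻¹ normalises E.
      normaliser-grows : ∀ {p} → p ∈ₛ M → p ∉ₛ E →
                         ¬ ¬ (∃ λ c → c ∈ₛ M × c ∉ₛ E × Normalises E (tr c))
      normaliser-grows {p} p∈M p∉E none =
        -- If nothing in `M` outside `E` normalised `E`, induction on the remaining depth would show
        -- that `tr p` does.
        none (p , p∈M , p∉E , all-normalise (proj₁ M-nil) (λ v →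
          subst (λ j → v ∈ K (Translations M) j) (sym (+-comm (proj₁ M-nil) 1))
            (K-weaken (proj₂ M-nil v))) (tr-Aut p∈M))
        where
        M-nil : Nil (Translations M)
        M-nil = nil M-max
        all-normalise : ∀ j {k g g⁻} → (∀ v → v ∈ K (Translations M) (j + k)) → Aut k g g⁻ → Normalises E g
        -- No depth remains: `δ g` annihilates every function, and indicators separate points, so
        -- `g` is the identity.
        all-normalise zero {k} {g} top G i i∈E =
          subst (_∈ₛ E) (sym (▷-id trivial i)) i∈E
          where
          indicator : X → V
          indicator s u with u ≟ s
          ... | yes _ = 1F
          ... | no  _ = 0F
          indicator-self : ∀ s → indicator s s ≡ 1F
          indicator-self s with s ≟ s
          ... | yes _   = refl
          ... | no  s≢s = contradiction refl s≢s
          indicator⁻ : ∀ s u → indicator s u ⊖ 1F ≡ 0F → u ≡ s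
          indicator⁻ s u eq with u ≟ s
          ... | yes u≡s = u≡s
          indicator⁻ s u () | no _
          trivial : g ≗ id
          trivial s with Aut.lowers G zero
                           (subst (λ j → indicator s ∈ K (Translations M) j) (sym (+-identityʳ k)) (top _))
          ... | base δ≡0 = indicator⁻ s (g s)
                             (trans (cong (indicator s (g s) ⊖_) (sym (indicator-self s))) (δ≡0 s))
        all-normalise (suc j) {k} {g} {g⁻} top G i i∈E with (g ▷ i) ∈? E
        ... | yes c∈E = c∈E
        ... | no  c∉E = contradiction (g ▷ i , c∈M , c∉E , c-normalises) none
          where
          open Aut G
          c∈M : (g ▷ i) ∈ₛ M
          c∈M = conj-closed hom inverseˡ preserves preserves⁻ (E⊆M i∈E)
          u : X → X
          u = tr⁻ i ∘ g ∘ tr i ∘ g⁻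
          c≗eu : ∀ s → tr (g ▷ i) s ≡ tr i (u s)
          c≗eu s = begin
            tr (g ▷ i) s             ≡⟨ cong (tr (g ▷ i)) (inverseˡ s) ⟨
            tr (g ▷ i) (g (g⁻ s))    ≡⟨ tr-▷ hom i (g⁻ s) ⟨
            g (tr i (g⁻ s))          ≡⟨ τ-inverse (src i) (tgt i) _ ⟨
            tr i (u s)               ∎
            where open ≡-Reasoning
          c-normalises : Normalises E (tr (g ▷ i))
          c-normalises i′ i′∈E =
            subst (_∈ₛ E) (sym (trans (▷-cong c≗eu i′) (▷-∘ (tr i) u i′)))
              (E-normal i∈E (all-normalise j
                (λ v → subst (λ l → v ∈ K (Translations M) l) (sym (+-suc j k)) (top v))
                (commutator-Aut (E⊆M i∈E) G) i′ i′∈E))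

  -- Induction on `E = M ∩ N`, larger intersections first. Otherwise there are `c` in `M` and `d` in
  -- `N`, both outside `E`, that normalise `E`. As two translations are unipotent, so is `E` with
  -- `c` and `d`; a maximal `R` above it meets both `M` and `N` in more than `E`, whence
  -- `M ⊆ R ⊆ N`.
  Maximal-⊆ : ∀ {M N} → Maximal M → Maximal N → M ⊆ₛ N
  Maximal-⊆ {M} {N} = go M N (⊃-wellFounded _)
    where
    go : ∀ M N → Acc _⊃_ (M ∩ₛ N) → Maximal M → Maximal N → M ⊆ₛ N
    go M N (acc rec) M-max N-max {p} p∈M = decidable-stable (p ∈? N) λ p∉N →
      N⊈M p∉N λ { (q , q∈N , q∉M) →
      normaliser-grows M-max E⊆M E-normal p∈M (λ p∈E → p∉N (E⊆N p∈E)) λ { (c , c∈M , c∉E , c-norm) →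
      normaliser-grows N-max E⊆N E-normal q∈N (λ q∈E → q∉M (E⊆M q∈E)) λ { (d , d∈N , d∉E , d-norm) →
      maximal-above ((E ∪ₛ ⁅ c ⁆) ∪ₛ ⁅ d ⁆) (enlarged-nil c-norm d-norm) λ { (R , R-max , ⊆R) →
      let E⊆R : E ⊆ₛ R
          E⊆R x∈ = ⊆R (p⊆p∪q ⁅ d ⁆ (p⊆p∪q ⁅ c ⁆ x∈))
          c∈R = ⊆R (p⊆p∪q ⁅ d ⁆ (q⊆p∪q E ⁅ c ⁆ (x∈⁅x⁆ c)))
          d∈R = ⊆R (q⊆p∪q (E ∪ₛ ⁅ c ⁆) ⁅ d ⁆ (x∈⁅x⁆ d))
          M⊆R = go M R (rec ((λ x∈ → x∈p∩q⁺ (E⊆M x∈ , E⊆R x∈)) , c , x∈p∩q⁺ (c∈M , c∈R) , c∉E))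
                  M-max R-max
          R⊆N = go R N (rec ((λ x∈ → x∈p∩q⁺ (E⊆R x∈ , E⊆N x∈)) , d , x∈p∩q⁺ (d∈R , d∈N) , d∉E))
                  R-max N-max
      in p∉N (R⊆N (M⊆R p∈M)) }}}}
      where
      E : Indices
      E = M ∩ₛ N
      E⊆M : E ⊆ₛ M
      E⊆M x∈ = proj₁ (x∈p∩q⁻ M N x∈)
      E⊆N : E ⊆ₛ N
      E⊆N x∈ = proj₂ (x∈p∩q⁻ M N x∈)
      E-normal : ∀ {e i} → e ∈ₛ E → i ∈ₛ E → (tr e ▷ i) ∈ₛ E
      E-normal e∈ i∈ = x∈p∩q⁺ ( self-normal M-max (E⊆M e∈) (E⊆M i∈)
                              , self-normal N-max (E⊆N e∈) (E⊆N i∈))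
      N⊈M : p ∉ₛ N → ¬ ¬ (∃ λ q → q ∈ₛ N × q ∉ₛ M)
      N⊈M p∉N none = p∉N (maximal N-max p (Nil-antitone
        (λ { (inj₁ (q , q∈N , refl)) → tr-Lowers M-max
               (decidable-stable (q ∈? M) (λ q∉M → none (q , q∈N , q∉M)))
           ; (inj₂ refl) → tr-Lowers M-max p∈M }) (nil M-max)))
      enlarged-nil : ∀ {c d} → Normalises E (tr c) → Normalises E (tr d) →
                     Nil (Translations ((E ∪ₛ ⁅ c ⁆) ∪ₛ ⁅ d ⁆))
      enlarged-nil {c} {d} c-norm d-norm = Nil-antitone (λ { (i , i∈ , refl) → ⊆-Lowers (member i∈) })
        (Nil-∪ (λ { (inj₁ refl) → preserves c c-norm ; (inj₂ refl) → preserves d d-norm })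
          (Nil-antitone (λ { (i , i∈ , refl) → tr-Lowers M-max (E⊆M i∈) }) (nil M-max))
          (Nil-two (src c) (tgt c) (src d) (tgt d)))
        where
        preserves : ∀ c → Normalises E (tr c) → tr c ∈ Preserves (Translations E)
        preserves c c-norm = Preserves-normaliser λ { (i , i∈ , refl) →
          tr (tr c ▷ i) , ⊆-Lowers (tr c ▷ i , c-norm i i∈ , refl) ,
          tr-▷ (τ-homomorphic (src c) (tgt c)) i }
        member : ∀ {i} → i ∈ₛ (E ∪ₛ ⁅ c ⁆) ∪ₛ ⁅ d ⁆ →
                 tr i ∈ (Translations E ∪ (λ g → g ≡ tr c ⊎ g ≡ tr d))
        member {i} i∈ with x∈p∪q⁻ (E ∪ₛ ⁅ c ⁆) ⁅ d ⁆ i∈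
        ... | inj₂ i∈d = inj₂ (inj₂ (cong tr (x∈⁅y⁆⇒x≡y d i∈d)))
        ... | inj₁ i∈′ with x∈p∪q⁻ E ⁅ c ⁆ i∈′
        ...   | inj₁ i∈E = inj₁ (i , i∈E , refl)
        ...   | inj₂ i∈c = inj₂ (inj₁ (cong tr (x∈⁅y⁆⇒x≡y c i∈c)))

  -- A single translation is unipotent because of its cube, so it lies in some maximal set, and by
  -- `Maximal-⊆` in any given one.
  Nil-translations : ¬ ¬ Nil (λ g → ∃ λ i → g ≡ tr i)
  Nil-translations k =
    maximal-above ∅ₛ (Nil-antitone (λ { (i , i∈ , refl) → ⊥-elim (∉⊥ i∈) }) Nil-∅)
      λ { (M , M-max , _) → k (Nil-antitone
        (λ { (i , refl) → tr-Lowers M-max (decidable-stable (i ∈? M) λ i∉M →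
          maximal-above ⁅ i ⁆ (Nil-antitone
            (λ { (j , j∈ , refl) → ⊆-Lowers (cong tr (x∈⁅y⁆⇒x≡y i j∈)) })
            (Nil-cube (τ-cube (src i) (tgt i))))
            λ { (N , N-max , i∈N) → i∉M (Maximal-⊆ N-max M-max (i∈N (x∈⁅x⁆ i))) }) })
        (nil M-max)) }

-- Counting up to a relation

-- Expresses that `P` has `m` classes, by representatives instead of a quotient type.
record Enum {a ℓ p} {A : Set a} (P : Pred A p) (_~_ : Rel A ℓ) (m : ℕ) : Set (a ⊔ ℓ ⊔ p) where
  field
    elem            : Fin m → A
    elem-∈          : ∀ i → elem i ∈ P
    elem-injective  : ∀ i j → elem i ~ elem j → i ≡ j
    elem-surjective : ∀ {x} → x ∈ P → ∃ λ i → x ~ elem i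

module _ {a ℓ : Level} {A : Set a} {_~_ : Rel A ℓ} where
  open Enum
  open U using (_⊆_)
  open ≡ using (refl; sym; trans; cong; cong₂; subst)

  enum-≤ : ∀ {p q} {P : Pred A p} {Q : Pred A q} {m n} → Symmetric _~_ → Transitive _~_ → P ⊆ Q →
           Enum P _~_ m → Enum Q _~_ n → m ≤ n
  enum-≤ {P = P} ~-sym ~-trans P⊆Q E F = injective⇒≤ {f = λ i → proj₁ (image i)} λ {i} {j} eq →
    elem-injective E i j (~-trans (proj₂ (image i))
      (~-sym (subst (λ k → elem E j ~ elem F k) (sym eq) (proj₂ (image j)))))
    where
    image : ∀ i → ∃ λ k → elem E i ~ elem F k
    image i = elem-surjective F (P⊆Q (elem-∈ E i))

  enum-unique : ∀ {p} {P : Pred A p} {m n} → Symmetric _~_ → Transitive _~_ →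
                Enum P _~_ m → Enum P _~_ n → m ≡ n
  enum-unique ~-sym ~-trans E F =
    ≤-antisym (enum-≤ ~-sym ~-trans id E F) (enum-≤ ~-sym ~-trans id F E)

  enum-× : ∀ {p} {P : Pred A p} {m k} (φ : Fin m → Fin k → A) → (∀ i j → φ i j ∈ P) →
           (∀ i j i′ j′ → φ i j ~ φ i′ j′ → i ≡ i′ × j ≡ j′) →
           (∀ {x} → x ∈ P → ∃₂ λ i j → x ~ φ i j) → Enum P _~_ (m * k)
  enum-× {P = P} {m} {k} φ φ∈ φ-inj φ-surj = record
    { elem            = λ u → φ (row u) (col u)
    ; elem-∈          = λ u → φ∈ (row u) (col u)
    ; elem-injective  = λ u v eq → let r , c = φ-inj (row u) (col u) (row v) (col v) eq in
        trans (sym (combine-remQuot {m} k u)) (trans (cong₂ combine r c) (combine-remQuot {m} k v))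
    ; elem-surjective = λ {x} x∈ → let i , j , x~ = φ-surj x∈ in combine i j ,
        subst (λ { (i , j) → x ~ φ i j }) (sym (remQuot-combine i j)) x~
    }
    where
    row : Fin (m * k) → Fin m
    row u = proj₁ (remQuot {m} k u)
    col : Fin (m * k) → Fin k
    col u = proj₂ (remQuot {m} k u)

  private
    Covers : ∀ {p N} → (Fin N → A) → Pred A p → Pred A _
    Covers e P x = x ∈ P × ∃ λ i → x ≡ e i

  classes : ∀ {p} {P : Pred A p} {N} → Decidable P → (∀ x y → Dec (x ~ y)) →
            (∀ {x} → x ~ x) → (∀ {x y} → x ∈ P → y ∈ P → x ~ y → y ~ x) →
            (e : Fin N → A) → ∃ (Enum (Covers e P) _~_)
  classes {N = zero} P? _~?_ ~-refl ~-sym e = 0 , record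
    { elem = λ () ; elem-∈ = λ () ; elem-injective = λ () ; elem-surjective = λ { (_ , () , _) } }
  classes {P = P} {N = suc N} P? _~?_ ~-refl ~-sym e
    with classes P? _~?_ ~-refl ~-sym (e ∘ suc) | P? (e zero)
  ... | m , E | no e₀∉P = m , record
    { elem = elem E
    ; elem-∈ = λ i → let x∈ , j , eq = elem-∈ E i in x∈ , suc j , eq
    ; elem-injective = elem-injective E
    ; elem-surjective = λ { (x∈ , zero , refl) → contradiction x∈ e₀∉P
                          ; (x∈ , suc j , eq) → elem-surjective E (x∈ , j , eq) }
    }
  ... | m , E | yes e₀∈P with any? (λ i → e zero ~? elem E i)
  ...   | yes (i , e₀~) = m , record
    { elem = elem E
    ; elem-∈ = λ i → let x∈ , j , eq = elem-∈ E i in x∈ , suc j , eq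
    ; elem-injective = elem-injective E
    ; elem-surjective = λ { (x∈ , zero , refl) → i , e₀~
                          ; (x∈ , suc j , eq) → elem-surjective E (x∈ , j , eq) }
    }
  ...   | no new = suc m , record
    { elem = elem′
    ; elem-∈ = λ { zero → e₀∈P , zero , refl
                 ; (suc i) → let x∈ , j , eq = elem-∈ E i in x∈ , suc j , eq }
    ; elem-injective = λ { zero    zero    _  → refl
                         ; zero    (suc j) eq → contradiction (j , eq) new
                         ; (suc i) zero    eq → contradiction (i , ~-sym (proj₁ (elem-∈ E i)) e₀∈P eq) new
                         ; (suc i) (suc j) eq → cong suc (elem-injective E i j eq) }
    ; elem-surjective = λ { (x∈ , zero , refl) → zero , ~-refl
                          ; (x∈ , suc j , eq) → let i , x~ = elem-surjective E (x∈ , j , eq) in suc i , x~ }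
    }
    where
    elem′ : Fin (suc m) → A
    elem′ zero    = e zero
    elem′ (suc i) = elem E i

  count-enum : ∀ {p} {P : Pred A p} {N} (P? : Decidable P) → (∀ {x} → x ~ x) →
               (e : Fin N → A) → (∀ i j → e i ~ e j → i ≡ j) →
               Enum (Covers e P) _~_ (count P? (tabulate e))
  count-enum {N = zero} P? ~-refl e e-inj = record
    { elem = λ () ; elem-∈ = λ () ; elem-injective = λ () ; elem-surjective = λ { (_ , () , _) } }
  count-enum {P = P} {N = suc N} P? ~-refl e e-inj
    with P? (e zero) | count-enum P? ~-refl (e ∘ suc) (λ i j eq → suc-injective (e-inj (suc i) (suc j) eq))
  ... | no e₀∉P | E = record
    { elem = elem E
    ; elem-∈ = λ i → let x∈ , j , eq = elem-∈ E i in x∈ , suc j , eq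
    ; elem-injective = elem-injective E
    ; elem-surjective = λ { (x∈ , zero , refl) → contradiction x∈ e₀∉P
                          ; (x∈ , suc j , eq) → elem-surjective E (x∈ , j , eq) }
    }
  ... | yes e₀∈P | E = record
    { elem = elem′
    ; elem-∈ = λ { zero → e₀∈P , zero , refl
                 ; (suc i) → let x∈ , j , eq = elem-∈ E i in x∈ , suc j , eq }
    ; elem-injective = λ
        { zero    zero    _  → refl
        ; zero    (suc j) eq → let _ , k , eq′ = elem-∈ E j in
            contradiction (e-inj zero (suc k) (subst (e zero ~_) eq′ eq)) λ ()
        ; (suc i) zero    eq → let _ , k , eq′ = elem-∈ E i in
            contradiction (e-inj (suc k) zero (subst (_~ e zero) eq′ eq)) λ ()
        ; (suc i) (suc j) eq → cong suc (elem-injective E i j eq) }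
    ; elem-surjective = λ { (x∈ , zero , refl) → zero , ~-refl
                          ; (x∈ , suc j , eq) → let i , x~ = elem-surjective E (x∈ , j , eq) in suc i , x~ }
    }
    where
    elem′ : Fin _ → A
    elem′ zero    = e zero
    elem′ (suc i) = elem E i

  -- The enumerating list may hit only one representative of each element of P.
  enum-complete : ∀ {p} {P : Pred A p} {N m} {e : Fin N → A} →
                  (∀ {x} → x ∈ P → ∃ λ i → e i ∈ P × x ~ e i) →
                  (∀ {x y z} → x ∈ P → y ∈ P → z ∈ P → x ~ y → y ~ z → x ~ z) →
                  Enum (Covers e P) _~_ m → Enum P _~_ m
  enum-complete onto ~-trans E = record
    { elem = elem E
    ; elem-∈ = λ i → proj₁ (elem-∈ E i)
    ; elem-injective = elem-injective E
    ; elem-surjective = λ x∈ → let i , ei∈ , x~ei = onto x∈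
                                   j , ei~ = elem-surjective E (ei∈ , i , refl)
                               in j , ~-trans x∈ ei∈ (proj₁ (elem-∈ E j)) x~ei ei~
    }

-- Laws valid up to `_~_` become equalities between indices of representatives, which gives a Hall
-- system on `Fin m`, as the induction on size requires.
module Induced {a p ℓ : Level} {A : Set a} {P : Pred A p} {_~_ : Rel A ℓ} {_•_ : Op₂ A}
  (~-equiv : IsEquivalence _~_)
  (•-cong   : ∀ {x x′ y y′} → x ~ x′ → y ~ y′ → (x • y) ~ (x′ • y′))
  (comm     : ∀ x y → (x • y) ~ (y • x))
  (idem     : ∀ x → (x • x) ~ x)
  (invol    : ∀ x y → (x • (x • y)) ~ y)
  (distrib  : ∀ x y z → (x • (y • z)) ~ ((x • y) • (x • z)))
  (closed   : ∀ {x y} → x ∈ P → y ∈ P → (x • y) ∈ P)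
  {m : ℕ} (E : Enum P _~_ m) where

  open Enum E
  module ~ = IsEquivalence ~-equiv

  private
    image : ∀ i j → ∃ λ k → (elem i • elem j) ~ elem k
    image i j = elem-surjective (closed (elem-∈ i) (elem-∈ j))

  _∗_ : Op₂ (Fin m)
  i ∗ j = proj₁ (image i j)

  private
    ∗-elem : ∀ i j → elem (i ∗ j) ~ (elem i • elem j)
    ∗-elem i j = ~.sym (proj₂ (image i j))

    by : ∀ {i j x y} → elem i ~ x → x ~ y → elem j ~ y → i ≡ j
    by p q r = elem-injective _ _ (~.trans p (~.trans q (~.sym r)))

  ∗-isHall : IsHallSystem _∗_
  ∗-isHall = record
    { •-comm    = λ x y → by (∗-elem x y) (comm (elem x) (elem y)) (∗-elem y x)
    ; •-idem    = λ x → by (∗-elem x x) (idem (elem x)) ~.refl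
    ; •-invol   = λ x y → by (∗-elem₂ x x y) (invol (elem x) (elem y)) ~.refl
    ; •-distrib = λ x y z → by (∗-elem₂ x y z) (distrib (elem x) (elem y) (elem z))
        (~.trans (∗-elem _ _) (•-cong (∗-elem x y) (∗-elem x z)))
    }
    where
    ∗-elem₂ : ∀ x y z → elem (x ∗ (y ∗ z)) ~ (elem x • (elem y • elem z))
    ∗-elem₂ x y z = ~.trans (∗-elem x (y ∗ z)) (•-cong ~.refl (∗-elem y z))

-- Orders of finite Hall systems

module Size {n : ℕ} {_•_ : Op₂ (Fin n)} (isHall : IsHallSystem _•_) where
  open HallSystem isHall
  open Unipotent (Fin n)
  open BaerSuzuki isHall using (X; tr; tr-combine; Nil-translations)
  open ≡ using (refl; sym; trans; cong; cong₂; module ≡-Reasoning)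

  Translation : Maps
  Translation g = ∃ λ i → g ≡ tr i

  -- Witnesses that translations act transitively; hence level 1 of their filtration consists of the
  -- constants.
  connect : X → X → X → X
  connect x y = τ (x • y) x

  connect-translation : ∀ x y → connect x y ∈ Translation
  connect-translation x y = _ , sym (tr-combine (x • y) x)

  connect-maps : ∀ x y → connect x y x ≡ y
  connect-maps x y = begin
    (x • y) • (x • x)  ≡⟨ cong ((x • y) •_) (•-idem x) ⟩
    (x • y) • x        ≡⟨ cong (_• x) (•-comm x y) ⟩
    (y • x) • x        ≡⟨ •-involʳ x y ⟩
    y                  ∎
    where open ≡-Reasoning

  constant : ∀ {v} → v ∈ K Translation 1 → ∀ x y → v x ≡ v y
  constant {v} (step v∈) x y with v∈ (connect-translation x y)
  ... | base δ≡0 = sym (trans (cong v (sym (connect-maps x y))) (⊖≡0⇒≡ (v (connect x y x)) (v x) (δ≡0 x)))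

  of-constant : ∀ {v} → (∀ x y → v x ≡ v y) → v ∈ K Translation 1
  of-constant {v} const = step λ {g} _ → base λ s → trans (cong (_⊖ v s) (const (g s) s)) (n⊖n (v s))

  Nonconstant : V → Set
  Nonconstant v = ¬ (∀ x y → v x ≡ v y)

  -- A function annihilated by all products of two operators δ is an affine functional on the Hall system.
  functional : {x y : X} → x ≢ y → ¬ ¬ (∃ λ v → v ∈ K Translation 2 × Nonconstant v)
  functional {x} {y} x≢y none = Nil-translations λ { (r , all) →
    contradiction (constant (collapse r (all indicator)) x y) indicator-separates }
    where
    indicator : V
    indicator u with u ≟ x
    ... | yes _ = 1F
    ... | no  _ = 0F
    indicator-separates : indicator x ≢ indicator y
    indicator-separates eq with x ≟ x | y ≟ x
    ... | no x≢x | _       = x≢x refl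
    ... | yes _  | yes y≡x = x≢y (sym y≡x)
    indicator-separates () | yes _ | no _
    K₂⊆K₁ : ∀ {v} → v ∈ K Translation 2 → v ∈ K Translation 1
    K₂⊆K₁ {v} v∈ = of-constant λ s t → decidable-stable (v s ≟ v t) λ v≢ →
      none (v , v∈ , λ const → v≢ (const s t))
    -- If level 2 contained only constants, every later level would collapse onto level 1 in turn.
    shrink : ∀ i {v} → v ∈ K Translation (2 + i) → v ∈ K Translation (1 + i)
    shrink zero    v∈        = K₂⊆K₁ v∈
    shrink (suc i) (step v∈) = step λ g∈ → shrink i (v∈ g∈)
    collapse : ∀ r {v} → v ∈ K Translation r → v ∈ K Translation 1
    collapse zero          v∈ = K-weaken v∈
    collapse (suc zero)    v∈ = v∈
    collapse (suc (suc r)) v∈ = collapse (suc r) (shrink r v∈)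

  module Fibres {v : V} (v∈ : v ∈ K Translation 2) where

    step-constant : ∀ a b s t → v (τ a b s) ⊖ v s ≡ v (τ a b t) ⊖ v t
    step-constant a b s t =
      constant {v = δ (τ a b) v} (apply v∈ (_ , sym (tr-combine a b))) s t

    Fibre : Pred X 0ℓ
    Fibre s = v s ≡ 0F

    closed : ∀ {a b} → a ∈ Fibre → b ∈ Fibre → (a • b) ∈ Fibre
    -- `τ a b` carries `b` to `a • b` and `a • b` to `a`, with equal increments of `v`; so the value
    -- at `a • b` equals its own negative.
    closed {a} {b} va≡0 vb≡0 = midpoint (v (a • b)) 0F (begin
      v (a • b) ⊖ 0F                          ≡⟨ cong₂ _⊖_ (cong (λ u → v (a • u)) (•-idem b)) vb≡0 ⟨
      v (τ a b b) ⊖ v b                       ≡⟨ step-constant a b b (a • b) ⟩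
      v (τ a b (a • b)) ⊖ v (a • b)           ≡⟨ cong (λ u → v u ⊖ v (a • b)) back ⟩
      v a ⊖ v (a • b)                         ≡⟨ cong (_⊖ v (a • b)) va≡0 ⟩
      0F ⊖ v (a • b)                          ∎)
      where
      open ≡-Reasoning
      back : τ a b (a • b) ≡ a
      back = trans (cong (a •_) (trans (•-comm b (a • b)) (•-involʳ b a))) (•-idem a)

    module _ {a b : X} {d : Fin 3} (d≢0 : d ≢ 0F) (rises : ∀ s → v (τ a b s) ⊖ v s ≡ d) where

      σ : X → X
      σ = τ a b

      power : Fin 3 → X → X
      power 0F s = s
      power 1F s = σ s
      power 2F s = σ (σ s)

      v-σ : ∀ s → v (σ s) ≡ d ⊖ (0F ⊖ v s)
      v-σ s = increment (v (σ s)) (v s) d (rises s)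

      v-power : ∀ i {s} → s ∈ Fibre → v (power i s) ≡ multiple d i
      v-power 0F     vs≡0 = vs≡0
      v-power 1F {s} vs≡0 = trans (v-σ s) (trans (cong (λ c → d ⊖ (0F ⊖ c)) vs≡0) (n⊖0 d))
      v-power 2F {s} vs≡0 = trans (v-σ (σ s)) (cong (λ c → d ⊖ (0F ⊖ c)) (v-power 1F vs≡0))

      σ-injective : ∀ {s t} → σ s ≡ σ t → s ≡ t
      σ-injective {s} {t} eq =
        trans (sym (τ-inverse b a s)) (trans (cong (τ b a) eq) (τ-inverse b a t))

      power-injective : ∀ i {s t} → power i s ≡ power i t → s ≡ t
      power-injective 0F eq = eq
      power-injective 1F eq = σ-injective eq
      power-injective 2F eq = σ-injective (σ-injective eq)

      lands : ∀ s → ∃₂ λ i t → t ∈ Fibre × s ≡ power i t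
      lands s with reaches-zero d (v s) d≢0
      ... | inj₁ vs≡0        = 0F , s , vs≡0 , refl
      -- When `σ s` lies in the fibre, two further applications of `σ` lead back to `s`.
      ... | inj₂ (inj₁ eq)   = 2F , σ s , trans (v-σ s) eq , sym (τ-cube a b s)
      ... | inj₂ (inj₂ eq)   = 1F , σ (σ s) ,
        trans (v-σ (σ s)) (trans (cong (λ c → d ⊖ (0F ⊖ c)) (v-σ s)) eq) , sym (τ-cube a b s)

      triple : ∀ {m} → Enum Fibre _≡_ m → n ≡ 3 * m
      triple {m} E = enum-unique sym trans everything
          (enum-× φ (λ _ _ → tt) φ-injective λ {x} _ → φ-surjective x)
        where
        module E = Enum E
        everything : Enum {A = X} (λ _ → ⊤) _≡_ n
        everything = record { elem = id ; elem-∈ = λ _ → tt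
                            ; elem-injective = λ _ _ eq → eq ; elem-surjective = λ {x} _ → x , refl }
        φ : Fin 3 → Fin m → X
        φ i j = power i (E.elem j)
        φ-injective : ∀ i j i′ j′ → φ i j ≡ φ i′ j′ → i ≡ i′ × j ≡ j′
        φ-injective i j i′ j′ eq with multiple-injective d i i′ d≢0
          (trans (sym (v-power i (E.elem-∈ j))) (trans (cong v eq) (v-power i′ (E.elem-∈ j′))))
        ... | refl = refl , E.elem-injective j j′ (power-injective i eq)
        φ-surjective : ∀ x → ∃₂ λ i j → x ≡ φ i j
        φ-surjective x with lands x
        ... | i , t , t∈ , x≡ with E.elem-surjective t∈
        ...   | j , t≡ = i , j , trans x≡ (cong (power i) t≡)

power-of-three : ∀ {n} {_•_ : Op₂ (Fin n)} → IsHallSystem _•_ → n ≢ 0 → ¬ ¬ (∃ λ k → n ≡ 3 ^ k)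
power-of-three isHall n≢0 = go (<-wellFounded _) isHall n≢0
  where
  open ≡ using (refl; sym; trans; cong; cong₂; subst; isEquivalence)
  go : ∀ {n} {_•_ : Op₂ (Fin n)} → Acc _<_ n → IsHallSystem _•_ → n ≢ 0 → ¬ ¬ (∃ λ k → n ≡ 3 ^ k)
  go {zero}  _ _ n≢0 _ = n≢0 refl
  go {suc zero} _ _ _ k = k (0 , refl)
  go {n@(suc (suc _))} {_•_} (acc rec) isHall n≢0 k =
    functional {zero} {suc zero} (λ ()) λ { (v , v∈ , nonconstant) →
    nonconstant λ x y → decidable-stable (v x ≟ v y) λ vx≢vy →
    descend v∈ x y vx≢vy }
    where
    open HallSystem isHall
    open Unipotent (Fin n)
    open Size isHall
    descend : ∀ {v} → v ∈ K Translation 2 → ∀ x y → v x ≢ v y → ⊥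
    descend {v} v∈ x y vx≢vy with classes {_~_ = _≡_} (λ s → v s ≟ 0F) _≟_ refl (λ _ _ → sym) id
    ... | m , E′ = go (rec m<n) ∗-isHall m≢0 λ { (l , m≡3^l) → k (suc l , trans n≡3m (cong (3 *_) m≡3^l)) }
      where
      open Fibres v∈
      E : Enum Fibre _≡_ m
      E = enum-complete (λ {x} x∈ → x , x∈ , refl) (λ _ _ _ → trans) E′
      open Induced {_•_ = _•_} isEquivalence (cong₂ _•_) •-comm •-idem •-invol •-distrib closed E
        using (∗-isHall)
      n≡3m : n ≡ 3 * m
      -- The translation carrying `x` to `y` raises `v` by `v y ⊖ v x` at `x`, hence everywhere.
      n≡3m = triple {x • y} {x} {v y ⊖ v x} (λ eq → vx≢vy (sym (⊖≡0⇒≡ (v y) (v x) eq)))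
        (λ s → trans (step-constant (x • y) x s x) (cong (λ u → v u ⊖ v x) (connect-maps x y))) E
      m≢0 : m ≢ 0
      m≢0 refl = contradiction n≡3m λ ()
      m<n : m < n
      m<n = subst (m <_) (sym n≡3m) (m<m+n m (positive m m≢0))
        where
        positive : ∀ m → m ≢ 0 → 0 < m + (m + 0)
        positive zero    m≢0 = contradiction refl m≢0
        positive (suc m) _   = s≤s z≤n

-- Moufang loops

-- Stated over an arbitrary equivalence, so that it applies to the loop modulo its nucleus without
-- forming the quotient.
module CommutativeMoufang {a ℓ : Level} {A : Set a} {_~_ : Rel A ℓ} (isEquivalence : IsEquivalence _~_)
  {_∙_ : Op₂ A} {_⁻¹ : Op₁ A} {ε : A}
  (∙-cong  : ∀ {x x′ y y′} → x ~ x′ → y ~ y′ → (x ∙ y) ~ (x′ ∙ y′))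
  (⁻¹-cong : ∀ {x y} → x ~ y → (x ⁻¹) ~ (y ⁻¹))
  (comm    : ∀ x y → (x ∙ y) ~ (y ∙ x))
  (identityˡ : ∀ x → (ε ∙ x) ~ x)
  (cancelˡ : ∀ x y → ((x ⁻¹) ∙ (x ∙ y)) ~ y)
  (⁻¹-involutive : ∀ x → ((x ⁻¹) ⁻¹) ~ x)
  (⁻¹-anti : ∀ x y → ((x ∙ y) ⁻¹) ~ ((y ⁻¹) ∙ (x ⁻¹)))
  (moufang : ∀ x y z → (((x ∙ y) ∙ x) ∙ z) ~ (x ∙ (y ∙ (x ∙ z)))) where

  open IsEquivalence isEquivalence

  setoid : Setoid a ℓ
  setoid = record { isEquivalence = isEquivalence }

  open SetoidReasoning setoid

  private
    congˡ : ∀ {x y z} → y ~ z → (x ∙ y) ~ (x ∙ z)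
    congˡ = ∙-cong refl
    congʳ : ∀ {x y z} → y ~ z → (y ∙ x) ~ (z ∙ x)
    congʳ p = ∙-cong p refl

  identityʳ : ∀ x → (x ∙ ε) ~ x
  identityʳ x = trans (comm x ε) (identityˡ x)

  cancelˡ′ : ∀ x y → (x ∙ ((x ⁻¹) ∙ y)) ~ y
  cancelˡ′ x y = trans (congʳ (sym (⁻¹-involutive x))) (cancelˡ (x ⁻¹) y)

  cancelʳ : ∀ x y → ((y ∙ x) ∙ (x ⁻¹)) ~ y
  cancelʳ x y = trans (comm _ _) (trans (congˡ (comm y x)) (cancelˡ x y))

  alternativeˡ : ∀ x y → ((x ∙ x) ∙ y) ~ (x ∙ (x ∙ y))
  alternativeˡ x y = begin
    (x ∙ x) ∙ y          ≈⟨ congʳ (congʳ (identityʳ x)) ⟨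
    ((x ∙ ε) ∙ x) ∙ y    ≈⟨ moufang x ε y ⟩
    x ∙ (ε ∙ (x ∙ y))    ≈⟨ congˡ (identityˡ _) ⟩
    x ∙ (x ∙ y)          ∎

  moufang₁ : ∀ x y z → (((x ∙ x) ∙ y) ∙ ((x ⁻¹) ∙ z)) ~ (x ∙ (y ∙ z))
  moufang₁ x y z = begin
    ((x ∙ x) ∙ y) ∙ ((x ⁻¹) ∙ z)       ≈⟨ congʳ (trans (alternativeˡ x y) (comm x _)) ⟩
    ((x ∙ y) ∙ x) ∙ ((x ⁻¹) ∙ z)       ≈⟨ moufang x y _ ⟩
    x ∙ (y ∙ (x ∙ ((x ⁻¹) ∙ z)))       ≈⟨ congˡ (congˡ (cancelˡ′ x z)) ⟩
    x ∙ (y ∙ z)                        ∎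

  -- `moufang₁` applied to `y ∙ z` and `z ⁻¹` removes `z` on the right; then the factor `v` is
  -- cancelled.
  moufang₂ : ∀ x y z → ((x ∙ x) ∙ (y ∙ z)) ~ ((x ∙ y) ∙ (x ∙ z))
  moufang₂ x y z = begin
    (x ∙ x) ∙ (y ∙ z)                            ≈⟨ cancelʳ v _ ⟨
    (((x ∙ x) ∙ (y ∙ z)) ∙ v) ∙ (v ⁻¹)           ≈⟨ congʳ (moufang₁ x (y ∙ z) (z ⁻¹)) ⟩
    (x ∙ ((y ∙ z) ∙ (z ⁻¹))) ∙ (v ⁻¹)
      ≈⟨ ∙-cong (congˡ (cancelʳ z y)) (trans (⁻¹-anti _ _) (∙-cong (⁻¹-involutive z) (⁻¹-involutive x))) ⟩
    (x ∙ y) ∙ (z ∙ x)                            ≈⟨ congˡ (comm z x) ⟩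
    (x ∙ y) ∙ (x ∙ z)                            ∎
    where v = (x ⁻¹) ∙ (z ⁻¹)

  -- This single law describes the centre, since commutativity supplies the other associations, as
  -- in `Central-middle`.
  Central : Pred A _
  Central k = ∀ y z → (k ∙ (y ∙ z)) ~ ((k ∙ y) ∙ z)

  cube : A → A
  cube x = x ∙ (x ∙ x)

  private
    -- `moufang₁` and `moufang₂` are autotopisms whose second components are multiplication by
    -- `x ⁻¹` and by `x`. These cancel in the composite, and an autotopism with trivial second
    -- component comes from a nuclear element.
    cube-autotopy : ∀ x y z → ((x ∙ ((x ∙ x) ∙ y)) ∙ z) ~ ((x ∙ x) ∙ (x ∙ (y ∙ z)))
    cube-autotopy x y z = begin
      (x ∙ ((x ∙ x) ∙ y)) ∙ z                        ≈⟨ congˡ (cancelˡ′ x z) ⟨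
      (x ∙ ((x ∙ x) ∙ y)) ∙ (x ∙ ((x ⁻¹) ∙ z))       ≈⟨ moufang₂ x _ _ ⟨
      (x ∙ x) ∙ (((x ∙ x) ∙ y) ∙ ((x ⁻¹) ∙ z))       ≈⟨ congˡ (moufang₁ x y z) ⟩
      (x ∙ x) ∙ (x ∙ (y ∙ z))                        ∎

  cube-∙ : ∀ x z → (cube x ∙ z) ~ ((x ∙ x) ∙ (x ∙ z))
  cube-∙ x z = begin
    cube x ∙ z                      ≈⟨ congʳ (congˡ (identityʳ _)) ⟨
    (x ∙ ((x ∙ x) ∙ ε)) ∙ z         ≈⟨ cube-autotopy x ε z ⟩
    (x ∙ x) ∙ (x ∙ (ε ∙ z))         ≈⟨ congˡ (congˡ (identityˡ z)) ⟩
    (x ∙ x) ∙ (x ∙ z)               ∎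

  cube-central : ∀ x → cube x ∈ Central
  cube-central x y z = begin
    cube x ∙ (y ∙ z)                  ≈⟨ cube-∙ x _ ⟩
    (x ∙ x) ∙ (x ∙ (y ∙ z))           ≈⟨ cube-autotopy x y z ⟨
    (x ∙ ((x ∙ x) ∙ y)) ∙ z           ≈⟨ congʳ shift ⟩
    (cube x ∙ y) ∙ z                  ∎
    where
    shift : (x ∙ ((x ∙ x) ∙ y)) ~ (cube x ∙ y)
    shift = begin
      x ∙ ((x ∙ x) ∙ y)           ≈⟨ identityʳ _ ⟨
      (x ∙ ((x ∙ x) ∙ y)) ∙ ε     ≈⟨ cube-autotopy x y ε ⟩
      (x ∙ x) ∙ (x ∙ (y ∙ ε))     ≈⟨ congˡ (congˡ (identityʳ y)) ⟩
      (x ∙ x) ∙ (x ∙ y)           ≈⟨ cube-∙ x y ⟨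
      cube x ∙ y                  ∎

  Central-resp : ∀ {k l} → k ~ l → k ∈ Central → l ∈ Central
  Central-resp k~l k∈ y z = trans (congʳ (sym k~l)) (trans (k∈ y z) (congʳ (congʳ k~l)))

  Central-ε : ε ∈ Central
  Central-ε y z = trans (identityˡ _) (congʳ (sym (identityˡ y)))

  Central-∙ : ∀ {k l} → k ∈ Central → l ∈ Central → (k ∙ l) ∈ Central
  Central-∙ {k} {l} k∈ l∈ y z = begin
    (k ∙ l) ∙ (y ∙ z)       ≈⟨ k∈ l _ ⟨
    k ∙ (l ∙ (y ∙ z))       ≈⟨ congˡ (l∈ y z) ⟩
    k ∙ ((l ∙ y) ∙ z)       ≈⟨ k∈ _ z ⟩
    (k ∙ (l ∙ y)) ∙ z       ≈⟨ congʳ (k∈ l y) ⟩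
    ((k ∙ l) ∙ y) ∙ z       ∎

  Central-⁻¹ : ∀ {k} → k ∈ Central → (k ⁻¹) ∈ Central
  Central-⁻¹ {k} k∈ y z = begin
    (k ⁻¹) ∙ (y ∙ z)                        ≈⟨ congˡ (congʳ (cancelˡ′ k y)) ⟨
    (k ⁻¹) ∙ ((k ∙ ((k ⁻¹) ∙ y)) ∙ z)       ≈⟨ congˡ (k∈ _ z) ⟨
    (k ⁻¹) ∙ (k ∙ (((k ⁻¹) ∙ y) ∙ z))       ≈⟨ cancelˡ k _ ⟩
    ((k ⁻¹) ∙ y) ∙ z                        ∎

  Central-middle : ∀ {k} → k ∈ Central → ∀ x y → ((x ∙ k) ∙ y) ~ (x ∙ (k ∙ y))
  Central-middle {k} k∈ x y = begin
    (x ∙ k) ∙ y      ≈⟨ congʳ (comm x k) ⟩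
    (k ∙ x) ∙ y      ≈⟨ k∈ x y ⟨
    k ∙ (x ∙ y)      ≈⟨ congˡ (comm x y) ⟩
    k ∙ (y ∙ x)      ≈⟨ k∈ y x ⟩
    (k ∙ y) ∙ x      ≈⟨ comm _ x ⟩
    x ∙ (k ∙ y)      ∎

  infix 4 _≋_
  _≋_ : Rel A _
  x ≋ y = ((x ⁻¹) ∙ y) ∈ Central

  ≋-intro : ∀ {x y k} → k ∈ Central → y ~ (x ∙ k) → x ≋ y
  ≋-intro {x} {y} {k} k∈ y~xk = Central-resp (sym (trans (congˡ y~xk) (cancelˡ x k))) k∈

  ≋-elim : ∀ {x} y → y ~ (x ∙ ((x ⁻¹) ∙ y))
  ≋-elim {x} y = sym (cancelˡ′ x y)

  ~⇒≋ : ∀ {x y} → x ~ y → x ≋ y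
  ~⇒≋ {x} {y} x~y = ≋-intro Central-ε (trans (sym x~y) (sym (identityʳ x)))

  ≋-isEquivalence : IsEquivalence _≋_
  ≋-isEquivalence = record
    { refl  = ~⇒≋ refl
    ; sym   = λ {x} {y} x≋y → Central-resp
        (trans (⁻¹-anti _ _) (congˡ (⁻¹-involutive x))) (Central-⁻¹ x≋y)
    ; trans = λ {x} {y} {z} x≋y y≋z → ≋-intro (Central-∙ x≋y y≋z) (begin
        z                                              ≈⟨ ≋-elim z ⟩
        y ∙ ((y ⁻¹) ∙ z)                               ≈⟨ congʳ (≋-elim y) ⟩
        (x ∙ ((x ⁻¹) ∙ y)) ∙ ((y ⁻¹) ∙ z)              ≈⟨ Central-middle x≋y x _ ⟩
        x ∙ (((x ⁻¹) ∙ y) ∙ ((y ⁻¹) ∙ z))              ∎)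
    }

  open IsEquivalence ≋-isEquivalence public
    using () renaming (refl to ≋-refl; sym to ≋-sym; trans to ≋-trans)

  ≋-∙-cong : ∀ {x x′ y y′} → x ≋ x′ → y ≋ y′ → (x ∙ y) ≋ (x′ ∙ y′)
  ≋-∙-cong {x} {x′} {y} {y′} x≋x′ y≋y′ = ≋-intro (Central-∙ x≋x′ y≋y′) (begin
    x′ ∙ y′                   ≈⟨ ∙-cong (≋-elim x′) (≋-elim y′) ⟩
    (x ∙ k) ∙ (y ∙ l)         ≈⟨ Central-middle x≋x′ x _ ⟩
    x ∙ (k ∙ (y ∙ l))         ≈⟨ congˡ (x≋x′ y l) ⟩
    x ∙ ((k ∙ y) ∙ l)         ≈⟨ congˡ (comm _ l) ⟩
    x ∙ (l ∙ (k ∙ y))         ≈⟨ Central-middle y≋y′ x _ ⟨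
    (x ∙ l) ∙ (k ∙ y)         ≈⟨ congʳ (comm x l) ⟩
    (l ∙ x) ∙ (k ∙ y)         ≈⟨ y≋y′ x _ ⟨
    l ∙ (x ∙ (k ∙ y))         ≈⟨ congˡ (Central-middle x≋x′ x y) ⟨
    l ∙ ((x ∙ k) ∙ y)         ≈⟨ congˡ (congʳ (comm x k)) ⟩
    l ∙ ((k ∙ x) ∙ y)         ≈⟨ congˡ (x≋x′ x y) ⟨
    l ∙ (k ∙ (x ∙ y))         ≈⟨ y≋y′ k _ ⟩
    (l ∙ k) ∙ (x ∙ y)         ≈⟨ ∙-cong (comm l k) refl ⟩
    (k ∙ l) ∙ (x ∙ y)         ≈⟨ comm _ _ ⟩
    (x ∙ y) ∙ (k ∙ l)         ∎)
    where
    k = (x ⁻¹) ∙ x′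
    l = (y ⁻¹) ∙ y′

  ≋-⁻¹-cong : ∀ {x y} → x ≋ y → (x ⁻¹) ≋ (y ⁻¹)
  ≋-⁻¹-cong {x} {y} x≋y = ≋-intro (Central-⁻¹ x≋y) (begin
    y ⁻¹                                ≈⟨ ⁻¹-cong (≋-elim y) ⟩
    (x ∙ ((x ⁻¹) ∙ y)) ⁻¹               ≈⟨ ⁻¹-anti _ _ ⟩
    (((x ⁻¹) ∙ y) ⁻¹) ∙ (x ⁻¹)          ≈⟨ comm _ _ ⟩
    (x ⁻¹) ∙ (((x ⁻¹) ∙ y) ⁻¹)          ∎)

  -- Modulo the centre the loop has exponent 3, and x • y is the third point of the line through x and y.
  infixl 7 _•_
  _•_ : Op₂ A
  x • y = (x ∙ y) ⁻¹

  •-cong : ∀ {x x′ y y′} → x ≋ x′ → y ≋ y′ → (x • y) ≋ (x′ • y′)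
  •-cong x≋x′ y≋y′ = ≋-⁻¹-cong (≋-∙-cong x≋x′ y≋y′)

  •-comm : ∀ x y → (x • y) ≋ (y • x)
  •-comm x y = ~⇒≋ (⁻¹-cong (comm x y))

  •-idem : ∀ x → (x • x) ≋ x
  •-idem x = Central-resp (trans (comm x _) (congʳ (sym (⁻¹-involutive _)))) (cube-central x)

  private
    •-expand : ∀ x u → (x • (u ⁻¹)) ~ ((x ⁻¹) ∙ u)
    •-expand x u = begin
      (x ∙ (u ⁻¹)) ⁻¹         ≈⟨ ⁻¹-anti x _ ⟩
      ((u ⁻¹) ⁻¹) ∙ (x ⁻¹)    ≈⟨ congʳ (⁻¹-involutive u) ⟩
      u ∙ (x ⁻¹)              ≈⟨ comm u _ ⟩
      (x ⁻¹) ∙ u              ∎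

  •-invol : ∀ x y → (x • (x • y)) ≋ y
  •-invol x y = ~⇒≋ (trans (•-expand x _) (cancelˡ x y))

  -- By `moufang₂` the right side is `x² (y z)`, which is `cube x` times the left side `x⁻¹ (y z)`.
  •-distrib : ∀ x y z → (x • (y • z)) ≋ ((x • y) • (x • z))
  •-distrib x y z = ≋-intro (cube-central x) (begin
    (x • y) • (x • z)                  ≈⟨ •-expand _ _ ⟩
    ((x • y) ⁻¹) ∙ (x ∙ z)             ≈⟨ congʳ (⁻¹-involutive _) ⟩
    (x ∙ y) ∙ (x ∙ z)                  ≈⟨ moufang₂ x y z ⟨
    (x ∙ x) ∙ (y ∙ z)                  ≈⟨ congˡ (cancelˡ′ x _) ⟨
    (x ∙ x) ∙ (x ∙ ((x ⁻¹) ∙ (y ∙ z)))  ≈⟨ cube-∙ x _ ⟨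
    cube x ∙ ((x ⁻¹) ∙ (y ∙ z))        ≈⟨ congˡ (•-expand x _) ⟨
    cube x ∙ (x • (y • z))             ≈⟨ comm _ _ ⟩
    (x • (y • z)) ∙ cube x             ∎)

-- The nucleus and left inner maps

module MoufangLoop {c ℓ : Level} (Q : Loop c ℓ) (moufang : LoopTheory.IsMoufang Q) where
  open Loop Q
  open LoopTheory Q
  open QuasigroupProperties quasigroup using (cancelˡ; y≈x\\z)
  open SetoidReasoning setoid

  infix 9 _⁻¹
  _⁻¹ : Op₁ Carrier
  x ⁻¹ = x \\ ε

  ⁻¹-cong : ∀ {x y} → x ≈ y → x ⁻¹ ≈ y ⁻¹
  ⁻¹-cong = \\-congʳ

  inverseʳ : ∀ x → x ∙ x ⁻¹ ≈ ε
  inverseʳ x = leftDividesˡ x ε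

  ⁻¹-cancelˡ : ∀ x y → x ⁻¹ ∙ (x ∙ y) ≈ y
  ⁻¹-cancelˡ x y = cancelˡ x _ _ (begin
    x ∙ (x ⁻¹ ∙ (x ∙ y))         ≈⟨ moufang x (x ⁻¹) y ⟨
    ((x ∙ x ⁻¹) ∙ x) ∙ y         ≈⟨ ∙-congʳ (trans (∙-congʳ (inverseʳ x)) (identityˡ x)) ⟩
    x ∙ y                        ∎)

  inverseˡ : ∀ x → x ⁻¹ ∙ x ≈ ε
  inverseˡ x = trans (∙-congˡ (sym (identityʳ x))) (⁻¹-cancelˡ x ε)

  ⁻¹-involutive : ∀ x → (x ⁻¹) ⁻¹ ≈ x
  ⁻¹-involutive x = sym (y≈x\\z (x ⁻¹) x ε (inverseˡ x))

  cancelˡ-⁻¹ : ∀ x y → x ∙ (x ⁻¹ ∙ y) ≈ y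
  cancelˡ-⁻¹ x y = trans (∙-congʳ (sym (⁻¹-involutive x))) (⁻¹-cancelˡ (x ⁻¹) y)

  \\≈⁻¹∙ : ∀ x y → x \\ y ≈ x ⁻¹ ∙ y
  \\≈⁻¹∙ x y = sym (y≈x\\z x _ y (cancelˡ-⁻¹ x y))

  ⁻¹-cancelʳ : ∀ x y → (y ∙ x) ∙ x ⁻¹ ≈ y
  ⁻¹-cancelʳ x y = begin
    (y ∙ x) ∙ x ⁻¹                       ≈⟨ ∙-congʳ (∙-congʳ (leftDividesˡ x y)) ⟨
    ((x ∙ (x \\ y)) ∙ x) ∙ x ⁻¹          ≈⟨ moufang x _ _ ⟩
    x ∙ ((x \\ y) ∙ (x ∙ x ⁻¹))          ≈⟨ ∙-congˡ (trans (∙-congˡ (inverseʳ x)) (identityʳ _)) ⟩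
    x ∙ (x \\ y)                         ≈⟨ leftDividesˡ x y ⟩
    y                                    ∎

  cancelʳ-⁻¹ : ∀ x y → (y ∙ x ⁻¹) ∙ x ≈ y
  cancelʳ-⁻¹ x y = trans (∙-congˡ (sym (⁻¹-involutive x))) (⁻¹-cancelʳ (x ⁻¹) y)

  ⁻¹-anti : ∀ x y → (x ∙ y) ⁻¹ ≈ y ⁻¹ ∙ x ⁻¹
  ⁻¹-anti x y = begin
    (x ∙ y) ⁻¹                                     ≈⟨ ⁻¹-cancelʳ x _ ⟨
    ((x ∙ y) ⁻¹ ∙ x) ∙ x ⁻¹                        ≈⟨ ∙-congʳ (∙-congˡ (⁻¹-cancelʳ y x)) ⟨
    ((x ∙ y) ⁻¹ ∙ ((x ∙ y) ∙ y ⁻¹)) ∙ x ⁻¹         ≈⟨ ∙-congʳ (⁻¹-cancelˡ _ _) ⟩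
    y ⁻¹ ∙ x ⁻¹                                    ∎

  alternativeˡ : ∀ x y → (x ∙ x) ∙ y ≈ x ∙ (x ∙ y)
  alternativeˡ x y = begin
    (x ∙ x) ∙ y           ≈⟨ ∙-congʳ (∙-congʳ (identityʳ x)) ⟨
    ((x ∙ ε) ∙ x) ∙ y     ≈⟨ moufang x ε y ⟩
    x ∙ (ε ∙ (x ∙ y))     ≈⟨ ∙-congˡ (identityˡ _) ⟩
    x ∙ (x ∙ y)           ∎

  alternativeʳ : ∀ x y → (y ∙ x) ∙ x ≈ y ∙ (x ∙ x)
  alternativeʳ x y = begin
    (y ∙ x) ∙ x                             ≈⟨ ⁻¹-involutive _ ⟨
    (((y ∙ x) ∙ x) ⁻¹) ⁻¹                   ≈⟨ ⁻¹-cong (trans (⁻¹-anti _ x) (∙-congˡ (⁻¹-anti y x))) ⟩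
    (x ⁻¹ ∙ (x ⁻¹ ∙ y ⁻¹)) ⁻¹               ≈⟨ ⁻¹-cong (alternativeˡ _ _) ⟨
    ((x ⁻¹ ∙ x ⁻¹) ∙ y ⁻¹) ⁻¹               ≈⟨ ⁻¹-cong (∙-congʳ (⁻¹-anti x x)) ⟨
    ((x ∙ x) ⁻¹ ∙ y ⁻¹) ⁻¹                  ≈⟨ ⁻¹-cong (⁻¹-anti y (x ∙ x)) ⟨
    ((y ∙ (x ∙ x)) ⁻¹) ⁻¹                   ≈⟨ ⁻¹-involutive _ ⟩
    y ∙ (x ∙ x)                             ∎

  -- In a Moufang loop the middle nucleus coincides with the left and the right one.
  Nuclear : Pred Carrier (c ⊔ ℓ)
  Nuclear n = ∀ x y → (x ∙ n) ∙ y ≈ x ∙ (n ∙ y)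

  Nuclear-resp : ∀ {n m} → n ≈ m → Nuclear n → Nuclear m
  Nuclear-resp n≈m n∈ x y =
    trans (∙-congʳ (∙-congˡ (sym n≈m))) (trans (n∈ x y) (∙-congˡ (∙-congʳ n≈m)))

  Nuclear-ε : Nuclear ε
  Nuclear-ε x y = ∙-cong (identityʳ x) (sym (identityˡ y))

  Nuclear-∙ : ∀ {n m} → Nuclear n → Nuclear m → Nuclear (n ∙ m)
  Nuclear-∙ {n} {m} n∈ m∈ x y = begin
    (x ∙ (n ∙ m)) ∙ y       ≈⟨ ∙-congʳ (n∈ x m) ⟨
    ((x ∙ n) ∙ m) ∙ y       ≈⟨ m∈ _ y ⟩
    (x ∙ n) ∙ (m ∙ y)       ≈⟨ n∈ x _ ⟩
    x ∙ (n ∙ (m ∙ y))       ≈⟨ ∙-congˡ (m∈ n y) ⟨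
    x ∙ ((n ∙ m) ∙ y)       ∎

  Nuclear-⁻¹ : ∀ {n} → Nuclear n → Nuclear (n ⁻¹)
  Nuclear-⁻¹ {n} n∈ x y = begin
    (x ∙ n ⁻¹) ∙ y                        ≈⟨ ∙-congˡ (cancelˡ-⁻¹ n y) ⟨
    (x ∙ n ⁻¹) ∙ (n ∙ (n ⁻¹ ∙ y))         ≈⟨ n∈ _ _ ⟨
    ((x ∙ n ⁻¹) ∙ n) ∙ (n ⁻¹ ∙ y)         ≈⟨ ∙-congʳ (cancelʳ-⁻¹ n x) ⟩
    x ∙ (n ⁻¹ ∙ y)                        ∎

  Nuclear-right : ∀ {n} → Nuclear n → ∀ x y → (x ∙ y) ∙ n ≈ x ∙ (y ∙ n)
  Nuclear-right {n} n∈ x y = begin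
    (x ∙ y) ∙ n                                     ≈⟨ ⁻¹-cancelʳ w _ ⟨
    (((x ∙ y) ∙ n) ∙ w) ∙ w ⁻¹                      ≈⟨ ∙-congʳ (n∈ (x ∙ y) w) ⟩
    ((x ∙ y) ∙ (n ∙ w)) ∙ w ⁻¹                      ≈⟨ ∙-congʳ (∙-congˡ (cancelˡ-⁻¹ n _)) ⟩
    ((x ∙ y) ∙ y ⁻¹) ∙ w ⁻¹                         ≈⟨ ∙-cong (⁻¹-cancelʳ y x) (⁻¹-anti _ _) ⟩
    x ∙ ((y ⁻¹) ⁻¹ ∙ (n ⁻¹) ⁻¹)                     ≈⟨ ∙-congˡ (∙-cong (⁻¹-involutive y) (⁻¹-involutive n)) ⟩
    x ∙ (y ∙ n)                                     ∎
    -- Chosen so that `n ∙ w ≈ y ⁻¹`, which undoes the factor `y`.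
    where w = n ⁻¹ ∙ y ⁻¹

  infix 4 _≈ₙ_
  _≈ₙ_ : Rel Carrier (c ⊔ ℓ)
  x ≈ₙ y = Nuclear (x ⁻¹ ∙ y)

  ≈ₙ-intro : ∀ {x y n} → Nuclear n → y ≈ x ∙ n → x ≈ₙ y
  ≈ₙ-intro {x} {y} {n} n∈ y≈xn = Nuclear-resp (sym (trans (∙-congˡ y≈xn) (⁻¹-cancelˡ x n))) n∈

  ≈ₙ-elim : ∀ {x} y → y ≈ x ∙ (x ⁻¹ ∙ y)
  ≈ₙ-elim {x} y = sym (cancelˡ-⁻¹ x y)

  ≈⇒≈ₙ : ∀ {x y} → x ≈ y → x ≈ₙ y
  ≈⇒≈ₙ {x} x≈y = ≈ₙ-intro Nuclear-ε (trans (sym x≈y) (sym (identityʳ x)))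

  ≈ₙ-isEquivalence : IsEquivalence _≈ₙ_
  ≈ₙ-isEquivalence = record
    { refl  = ≈⇒≈ₙ refl
    ; sym   = λ {x} {y} x≈y → Nuclear-resp
        (trans (⁻¹-anti _ _) (∙-congˡ (⁻¹-involutive x))) (Nuclear-⁻¹ x≈y)
    ; trans = λ {x} {y} {z} x≈y y≈z → ≈ₙ-intro (Nuclear-∙ x≈y y≈z) (begin
        z                                              ≈⟨ ≈ₙ-elim z ⟩
        y ∙ (y ⁻¹ ∙ z)                                 ≈⟨ ∙-congʳ (≈ₙ-elim y) ⟩
        (x ∙ (x ⁻¹ ∙ y)) ∙ (y ⁻¹ ∙ z)                  ≈⟨ x≈y x _ ⟩
        x ∙ ((x ⁻¹ ∙ y) ∙ (y ⁻¹ ∙ z))                  ∎)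
    }

  inner : Carrier → Carrier → Inverse setoid setoid
  inner x y = Composition.inverse (Composition.inverse (L y) (L x)) (Symmetry.inverse (L (x ∙ y)))

  ⟦inner⟧ : Carrier → Carrier → Carrier → Carrier
  ⟦inner⟧ x y z = (x ∙ y) \\ (x ∙ (y ∙ z))

  inner-isInner : ∀ x y → IsLeftInner (inner x y)
  inner-isInner x y =
      composition (composition (generator y) (generator x)) (inversion (generator (x ∙ y)))
    , trans (\\-congˡ (trans (∙-congˡ (identityʳ y)) (sym (identityʳ _)))) (leftDividesʳ _ ε)

  -- Right alternativity in disguise. It makes the map `γ` along a shift `u` fix `u`, which keeps
  -- the translated coset inside `S`.
  inner-fixes : ∀ x y → ⟦inner⟧ x y y ≈ y
  inner-fixes x y = sym (y≈x\\z _ y _ (alternativeʳ y x))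

  inner-nuclear : ∀ x y {n} → Nuclear n → ⟦inner⟧ x y n ≈ n
  inner-nuclear x y {n} n∈ = sym (y≈x\\z _ n _ (Nuclear-right n∈ x y))

  module LeftAutomorphic (leftAut : IsLeftAutomorphic) where

    module Inner (x y : Carrier) =
      IsLoopIsomorphism (leftAut (inner x y) (inner-isInner x y))

    -- The autotopism (u ↦ x u x , L_x⁻¹ , L_x) composed along x, y and (x y)⁻¹ has the left
    -- inner map as third component; as that map is an automorphism, the value c of the second
    -- component at 1 is nuclear.
    commutator-nuclear : ∀ x y → Nuclear ((x ∙ y) ∙ (x ⁻¹ ∙ y ⁻¹))
    commutator-nuclear x y a b = begin
      (a ∙ k) ∙ b                                ≈⟨ ∙-congˡ (leftDividesʳ k b) ⟨
      (a ∙ k) ∙ (k \\ (k ∙ b))                   ≈⟨ surjective (a ∙ k) (k \\ (k ∙ b)) ⟩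
      ((a ∙ k) ∙ k ⁻¹) ∙ (k ∙ (k \\ (k ∙ b)))    ≈⟨ ∙-cong (⁻¹-cancelʳ k a) (leftDividesˡ k _) ⟩
      a ∙ (k ∙ b)                                ∎
      where
      w k : Carrier
      w = x ∙ y
      k = w ∙ (x ⁻¹ ∙ y ⁻¹)
      γ γ⁻ P α β : Carrier → Carrier
      γ = ⟦inner⟧ x y
      γ⁻ = Inverse.from (inner x y)
      P a = (x ∙ ((y ∙ a) ∙ y)) ∙ x
      α a = (w ⁻¹ ∙ P a) ∙ w ⁻¹
      β b = w ∙ (x ⁻¹ ∙ (y ⁻¹ ∙ b))
      sandwich : ∀ x a b → ((x ∙ a) ∙ x) ∙ (x ⁻¹ ∙ b) ≈ x ∙ (a ∙ b)
      sandwich x a b = trans (moufang x a _) (∙-congˡ (∙-congˡ (cancelˡ-⁻¹ x b)))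
      autotopism : ∀ a b → α a ∙ β b ≈ γ (a ∙ b)
      autotopism a b = begin
        ((w ⁻¹ ∙ P a) ∙ w ⁻¹) ∙ (w ∙ t)               ≈⟨ ∙-congˡ (∙-congʳ (⁻¹-involutive w)) ⟨
        ((w ⁻¹ ∙ P a) ∙ w ⁻¹) ∙ ((w ⁻¹) ⁻¹ ∙ t)       ≈⟨ sandwich (w ⁻¹) (P a) t ⟩
        w ⁻¹ ∙ (P a ∙ t)                              ≈⟨ ∙-congˡ (sandwich x _ _) ⟩
        w ⁻¹ ∙ (x ∙ (((y ∙ a) ∙ y) ∙ (y ⁻¹ ∙ b)))     ≈⟨ ∙-congˡ (∙-congˡ (sandwich y a b)) ⟩
        w ⁻¹ ∙ (x ∙ (y ∙ (a ∙ b)))                    ≈⟨ \\≈⁻¹∙ _ _ ⟨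
        γ (a ∙ b)                                     ∎
        where t = x ⁻¹ ∙ (y ⁻¹ ∙ b)
      βε : β ε ≈ k
      βε = ∙-congˡ (∙-congˡ (identityʳ _))
      α≈ : ∀ a → α a ≈ γ a ∙ k ⁻¹
      α≈ a = begin
        α a                     ≈⟨ ⁻¹-cancelʳ k _ ⟨
        (α a ∙ k) ∙ k ⁻¹        ≈⟨ ∙-congʳ (∙-congˡ βε) ⟨
        (α a ∙ β ε) ∙ k ⁻¹
          ≈⟨ ∙-congʳ (trans (autotopism a ε) (Inverse.to-cong (inner x y) (identityʳ a))) ⟩
        γ a ∙ k ⁻¹              ∎
      αε : α ε ≈ k ⁻¹
      αε = trans (α≈ ε) (trans (∙-congʳ (proj₂ (inner-isInner x y))) (identityˡ _))
      β≈ : ∀ b → β b ≈ k ∙ γ b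
      β≈ b = begin
        β b                     ≈⟨ cancelˡ-⁻¹ k _ ⟨
        k ∙ (k ⁻¹ ∙ β b)        ≈⟨ ∙-congˡ (∙-congʳ αε) ⟨
        k ∙ (α ε ∙ β b)
          ≈⟨ ∙-congˡ (trans (autotopism ε b) (Inverse.to-cong (inner x y) (identityˡ b))) ⟩
        k ∙ γ b                 ∎
      surjective : ∀ a b → a ∙ b ≈ (a ∙ k ⁻¹) ∙ (k ∙ b)
      surjective a b = begin
        a ∙ b                                    ≈⟨ ∙-cong (γγ⁻ a) (γγ⁻ b) ⟨
        γ (γ⁻ a) ∙ γ (γ⁻ b)                      ≈⟨ Inner.∙-homo x y _ _ ⟨
        γ (γ⁻ a ∙ γ⁻ b)                          ≈⟨ autotopism _ _ ⟨
        α (γ⁻ a) ∙ β (γ⁻ b)                      ≈⟨ ∙-cong (α≈ _) (β≈ _) ⟩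
        (γ (γ⁻ a) ∙ k ⁻¹) ∙ (k ∙ γ (γ⁻ b))       ≈⟨ ∙-cong (∙-congʳ (γγ⁻ a)) (∙-congˡ (γγ⁻ b)) ⟩
        (a ∙ k ⁻¹) ∙ (k ∙ b)                     ∎
        where
        γγ⁻ : ∀ u → γ (γ⁻ u) ≈ u
        γγ⁻ = Inverse.strictlyInverseˡ (inner x y)

    ∙-commₙ : ∀ x y → x ∙ y ≈ₙ y ∙ x
    ∙-commₙ x y = Nuclear-resp
      (∙-cong (sym (⁻¹-anti x y)) (∙-cong (⁻¹-involutive y) (⁻¹-involutive x)))
      (commutator-nuclear (y ⁻¹) (x ⁻¹))

    -- Nuclear commutators make the nucleus normal: `n ∙ y` is `y ∙ n` up to the nuclear factor `q`,
    -- so all nuclear factors can be collected on the right.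
    ∙-congₙ : ∀ {x x′ y y′} → x ≈ₙ x′ → y ≈ₙ y′ → x ∙ y ≈ₙ x′ ∙ y′
    ∙-congₙ {x} {x′} {y} {y′} n∈ m∈ = ≈ₙ-intro r∈ (begin
      x′ ∙ y′                     ≈⟨ ∙-cong (≈ₙ-elim x′) (≈ₙ-elim y′) ⟩
      (x ∙ n) ∙ (y ∙ m)           ≈⟨ n∈ x _ ⟩
      x ∙ (n ∙ (y ∙ m))           ≈⟨ ∙-congˡ (Nuclear-right m∈ n y) ⟨
      x ∙ ((n ∙ y) ∙ m)           ≈⟨ ∙-congˡ (∙-congʳ (≈ₙ-elim (n ∙ y))) ⟩
      x ∙ (((y ∙ n) ∙ q) ∙ m)     ≈⟨ ∙-congˡ (q∈ (y ∙ n) m) ⟩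
      x ∙ ((y ∙ n) ∙ (q ∙ m))     ≈⟨ ∙-congˡ (n∈ y _) ⟩
      x ∙ (y ∙ (n ∙ (q ∙ m)))     ≈⟨ Nuclear-right r∈ x y ⟨
      (x ∙ y) ∙ (n ∙ (q ∙ m))     ∎)
      where
      n = x ⁻¹ ∙ x′
      m = y ⁻¹ ∙ y′
      q = (y ∙ n) ⁻¹ ∙ (n ∙ y)
      q∈ : Nuclear q
      q∈ = ∙-commₙ y n
      r∈ : Nuclear (n ∙ (q ∙ m))
      r∈ = Nuclear-∙ n∈ (Nuclear-∙ q∈ m∈)

    ⁻¹-congₙ : ∀ {x y} → x ≈ₙ y → x ⁻¹ ≈ₙ y ⁻¹
    ⁻¹-congₙ {x} {y} x≈y = IsEquivalence.trans ≈ₙ-isEquivalence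
      (≈ₙ-intro (Nuclear-⁻¹ x≈y) refl)
      (IsEquivalence.trans ≈ₙ-isEquivalence (∙-commₙ _ _)
        (≈⇒≈ₙ (trans (sym (⁻¹-anti x _)) (⁻¹-cong (cancelˡ-⁻¹ x y)))))

    module Quotient = CommutativeMoufang ≈ₙ-isEquivalence ∙-congₙ ⁻¹-congₙ ∙-commₙ
      (λ x → ≈⇒≈ₙ (identityˡ x)) (λ x y → ≈⇒≈ₙ (⁻¹-cancelˡ x y)) (λ x → ≈⇒≈ₙ (⁻¹-involutive x))
      (λ x y → ≈⇒≈ₙ (⁻¹-anti x y)) (λ x y z → ≈⇒≈ₙ (moufang x y z))

-- Divisibility of subloop orders

private
  ^-≤⇒∣ : ∀ b .{{_ : NonZero b}} i j → b ^ i ≤ b ^ j → b ^ i ∣ b ^ j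
  ^-≤⇒∣ b i j b^i≤b^j with ≤-total i j
  ... | inj₁ i≤j = ≡.subst (b ^ i ∣_)
    (≡.trans (≡.sym (^-distribˡ-+-* b i (j ∸ i))) (≡.cong (b ^_) (m+[n∸m]≡n i≤j)))
    (m∣m*n (b ^ (j ∸ i)))
  -- The powers agree here, either because the exponents do or because `b` is 1.
  ... | inj₂ j≤i = ∣-reflexive (≤-antisym b^i≤b^j (^-monoʳ-≤ b j≤i))

module Lagrange {c ℓ : Level} (Q : Loop c ℓ) where
  open Loop Q
  open LoopTheory Q

  module FiniteLoop (fin : Finite) where
    open Finite fin
    open Inverse enumeration using (to; from; strictlyInverseˡ; from-cong)

    to-injective : ∀ i j → to i ≈ to j → i ≡ j
    to-injective i j eq = ≡.trans (≡.sym (Inverse.strictlyInverseʳ enumeration i))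
      (≡.trans (from-cong eq) (Inverse.strictlyInverseʳ enumeration j))

    infix 4 _≈?_
    _≈?_ : ∀ x y → Dec (x ≈ y)
    x ≈? y = map′
      (λ eq → trans (sym (strictlyInverseˡ x)) (trans (reflexive (≡.cong to eq)) (strictlyInverseˡ y)))
      from-cong (from x ≟ from y)

    ∀? : ∀ {p} {P : Pred Carrier p} → (∀ {x y} → x ≈ y → P x → P y) → Decidable P → Dec (∀ x → P x)
    ∀? resp P? = map′ (λ all x → resp (strictlyInverseˡ x) (all (from x))) (λ all i → all (to i))
      (all? (λ i → P? (to i)))

    module _ {p} (P : Subset p) where
      open Subset P

      private
        onto : ∀ {r} {_~_ : Rel Carrier r} → (∀ {x y} → x ≈ y → x ~ y) →
               ∀ {x} → x ∈ pred → ∃ λ i → to i ∈ pred × x ~ to i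
        onto ≈⇒~ {x} x∈ = from x , resp (sym (strictlyInverseˡ x)) x∈ , ≈⇒~ (sym (strictlyInverseˡ x))

      card-enum : Enum pred _≈_ (card fin P)
      card-enum = enum-complete (onto id) (λ _ _ _ → trans) (count-enum dec refl to to-injective)

      -- The laws are asked inside `P` only: transitivity of the coset relation of `T` will rest on
      -- centrality modulo the nucleus.
      class-enum : ∀ {r} {_~_ : Rel Carrier r} → (∀ x y → Dec (x ~ y)) → (∀ {x y} → x ≈ y → x ~ y) →
                   (∀ {x y} → x ∈ pred → y ∈ pred → x ~ y → y ~ x) →
                   (∀ {x y z} → x ∈ pred → y ∈ pred → z ∈ pred → x ~ y → y ~ z → x ~ z) →
                   ∃ (Enum pred _~_)
      class-enum _~?_ ≈⇒~ ~-sym ~-trans =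
        let m , E = classes dec _~?_ (≈⇒~ refl) ~-sym to in m , enum-complete (onto ≈⇒~) ~-trans E

    -- The second premise keeps cosets of distinct representatives apart, the third makes them
    -- exhaust `B`; within one coset left cancellation suffices.
    coset-enum : ∀ {p q r} {A : Pred Carrier p} {B : Pred Carrier q} {_~_ : Rel Carrier r} {m k} →
                 (∀ {b a} → b ∈ B → a ∈ A → b ∙ a ∈ B) →
                 (∀ {b b′ a a′} → b ∈ B → b′ ∈ B → a ∈ A → a′ ∈ A → b ∙ a ≈ b′ ∙ a′ → b ~ b′) →
                 (∀ {b b′} → b ∈ B → b′ ∈ B → b′ ~ b → b \\ b′ ∈ A) →
                 Enum B _~_ m → Enum A _≈_ k → Enum B _≈_ (m * k)
    coset-enum {A = A} {B} {_~_} {m} {k} closed meet coset E F =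
      enum-× φ (λ i j → closed (E.elem-∈ i) (F.elem-∈ j)) φ-injective φ-surjective
      where
      module E = Enum E
      module F = Enum F
      φ : Fin m → Fin k → Carrier
      φ i j = E.elem i ∙ F.elem j
      φ-injective : ∀ i j i′ j′ → φ i j ≈ φ i′ j′ → i ≡ i′ × j ≡ j′
      φ-injective i j i′ j′ eq with E.elem-injective i i′
        (meet (E.elem-∈ i) (E.elem-∈ i′) (F.elem-∈ j) (F.elem-∈ j′) eq)
      ... | ≡.refl = ≡.refl ,
        F.elem-injective j j′ (QuasigroupProperties.cancelˡ quasigroup (E.elem i) _ _ eq)
      φ-surjective : ∀ {x} → x ∈ B → ∃₂ λ i j → x ≈ φ i j
      φ-surjective {x} x∈ with E.elem-surjective x∈
      ... | i , x~r with F.elem-surjective (coset (E.elem-∈ i) x∈ x~r)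
      ...   | j , eq = i , j , trans (sym (leftDividesˡ _ x)) (∙-congˡ eq)

  module Subloop {p} {S : Subset p} (S≤ : IsSubloop S) (moufang : IsMoufang) where
    open IsSubloop S≤
    open MoufangLoop Q moufang using (_⁻¹; \\≈⁻¹∙)

    ⁻¹-closed : ∀ {x} → x ∈ Subset.pred S → x ⁻¹ ∈ Subset.pred S
    ⁻¹-closed x∈ = \\-closed x∈ ε-closed

    ⁻¹∙-closed : ∀ {x y} → x ∈ Subset.pred S → y ∈ Subset.pred S → x ⁻¹ ∙ y ∈ Subset.pred S
    ⁻¹∙-closed x∈ y∈ = ∙-closed (⁻¹-closed x∈) y∈

  module _ (fin : Finite) (moufang : IsMoufang) (leftAut : IsLeftAutomorphic) where
    open FiniteLoop fin
    open MoufangLoop Q moufang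
    open LeftAutomorphic leftAut
    open Quotient using (_≋_; Central)
    open SetoidReasoning setoid
    module ≈ₙ = IsEquivalence ≈ₙ-isEquivalence

    nuclear? : Decidable Nuclear
    nuclear? n = ∀? (λ x≈y h z → trans (∙-congʳ (∙-congʳ (sym x≈y))) (trans (h z) (∙-congʳ x≈y)))
      λ x → ∀? (λ y≈z h → trans (∙-congˡ (sym y≈z)) (trans h (∙-congˡ (∙-congˡ y≈z))))
      λ y → (x ∙ n) ∙ y ≈? x ∙ (n ∙ y)

    infix 4 _≈ₙ?_
    _≈ₙ?_ : ∀ x y → Dec (x ≈ₙ y)
    x ≈ₙ? y = nuclear? (x ⁻¹ ∙ y)

    central? : Decidable Central
    central? k = ∀? (λ x≈y h z → ≈ₙ.trans (≈⇒≈ₙ (∙-congˡ (∙-congʳ (sym x≈y))))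
        (≈ₙ.trans (h z) (≈⇒≈ₙ (∙-congʳ (∙-congˡ x≈y)))))
      λ x → ∀? (λ y≈z h → ≈ₙ.trans (≈⇒≈ₙ (∙-congˡ (∙-congˡ (sym y≈z))))
        (≈ₙ.trans h (≈⇒≈ₙ (∙-congˡ y≈z))))
      λ y → (k ∙ (x ∙ y)) ≈ₙ? ((k ∙ x) ∙ y)

    _≋?_ : ∀ x y → Dec (x ≋ y)
    x ≋? y = central? (x ⁻¹ ∙ y)

    ≈⇒≋ : ∀ {x y} → x ≈ y → x ≋ y
    ≈⇒≋ x≈y = Quotient.~⇒≋ (≈⇒≈ₙ x≈y)

    centralSubset : Subset _
    centralSubset = record
      { pred = Central
      ; resp = λ x≈y → Quotient.Central-resp (≈⇒≈ₙ x≈y)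
      ; dec  = central?
      }

    module Sizes {p : Level} {S : Subset p} (S≤ : IsSubloop S) where
      open IsSubloop S≤
      open Subloop S≤ moufang

      reduced : ∃ (Enum (Subset.pred S) _≋_)
      reduced = class-enum S _≋?_ ≈⇒≋ (λ _ _ → Quotient.≋-sym) (λ _ _ _ → Quotient.≋-trans)

      index : ℕ
      index = proj₁ reduced

      -- Factors that are central modulo the nucleus do not change the class for `_≋_`, so each
      -- class in `S` is a translate of the central part of `S`.
      card-decompose : card fin S ≡ index * card fin (S ∩ centralSubset)
      card-decompose = enum-unique sym trans (card-enum S) (coset-enum
        (λ b∈ a∈ → ∙-closed b∈ (proj₁ a∈))
        (λ {b} {b′} _ _ a∈ a′∈ eq → Quotient.≋-trans (Quotient.≋-intro (proj₂ a∈) (≈ₙ.refl {b ∙ _}))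
          (Quotient.≋-trans (≈⇒≋ eq) (Quotient.≋-sym (Quotient.≋-intro (proj₂ a′∈) (≈ₙ.refl {b′ ∙ _})))))
        (λ b∈ b′∈ b′≋b → \\-closed b∈ b′∈ ,
          Quotient.Central-resp (≈⇒≈ₙ (sym (\\≈⁻¹∙ _ _))) (Quotient.≋-sym b′≋b))
        (proj₂ reduced) (card-enum (S ∩ centralSubset)))

      index-power : ¬ ¬ (∃ λ k → index ≡ 3 ^ k)
      index-power = power-of-three ∗-isHall index≢0
        where
        open Induced Quotient.≋-isEquivalence Quotient.•-cong Quotient.•-comm Quotient.•-idem
          Quotient.•-invol Quotient.•-distrib (λ x∈ y∈ → ⁻¹-closed (∙-closed x∈ y∈)) (proj₂ reduced)
        index≢0 : index ≢ 0
        index≢0 eq = ¬Fin0 (≡.subst Fin eq (proj₁ (Enum.elem-surjective (proj₂ reduced) ε-closed)))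

    module _ {p : Level} {S T : Subset p} (S≤ : IsSubloop S) (T≤ : IsSubloop T) (T⊆S : T ⊆ S)
             (nuclear⊆ : ∀ {n} → Nuclear n → n ∈ Subset.pred S → n ∈ Subset.pred T) where
      private
        module S = IsSubloop S≤
        module T = IsSubloop T≤
        module S′ = Subloop S≤ moufang
        module T′ = Subloop T≤ moufang
        module SizeS = Sizes S≤
        module SizeT = Sizes T≤
        S∩Z T∩Z : Subset _
        S∩Z = S ∩ centralSubset
        T∩Z = T ∩ centralSubset

      -- Associativity holds up to a nuclear factor of S, which lies in T.
      coset-∙ : ∀ {b k t} → b ∈ Subset.pred S → k ∈ Subset.pred T∩Z → t ∈ Subset.pred T →
                b \\ ((b ∙ k) ∙ t) ∈ Subset.pred T
      coset-∙ {b} {k} {t} b∈ (k∈ , k-central) t∈ = Subset.resp T (y≈ (begin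
          (b ∙ k) ∙ t              ≈⟨ ≈ₙ-elim _ ⟩
          (b ∙ (k ∙ t)) ∙ n        ≈⟨ Nuclear-right n∈N b _ ⟩
          b ∙ ((k ∙ t) ∙ n)        ∎)) (T.∙-closed (T.∙-closed k∈ t∈) n∈T)
        where
        open QuasigroupProperties quasigroup using (y≈x\\z)
        y≈ : ∀ {z u} → z ≈ b ∙ u → u ≈ b \\ z
        y≈ eq = y≈x\\z b _ _ (sym eq)
        n : Carrier
        n = (b ∙ (k ∙ t)) ⁻¹ ∙ ((b ∙ k) ∙ t)
        n∈N : Nuclear n
        n∈N = ≈ₙ.sym (Quotient.Central-middle k-central b t)
        n∈T : n ∈ Subset.pred T
        n∈T = nuclear⊆ n∈N (S′.⁻¹∙-closed (S.∙-closed b∈ (S.∙-closed (T⊆S k∈) (T⊆S t∈)))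
                                          (S.∙-closed (S.∙-closed b∈ (T⊆S k∈)) (T⊆S t∈)))

      central-card : card fin T∩Z ∣ card fin S∩Z
      central-card = divides m (enum-unique sym trans (card-enum S∩Z) (coset-enum
          (λ { (b∈ , b-c) (a∈ , a-c) → S.∙-closed b∈ (T⊆S a∈) , Quotient.Central-∙ b-c a-c })
          -- Here `b′` is `(b ∙ a) ∙ a′ ⁻¹`, and `a` is central modulo the nucleus, so `coset-∙`
          -- applies.
          (λ { {b} {b′} {a} {a′} (b∈ , _) _ a∈ (a′∈ , _) eq → Subset.resp T
               (\\-congˡ (trans (∙-congʳ eq) (⁻¹-cancelʳ a′ b′)))
               (coset-∙ b∈ a∈ (T′.⁻¹-closed a′∈)) })
          (λ b∈ b′∈ b′~b → ~-sym b′∈ b∈ b′~b , quotient-central b∈ b′∈)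
          E (card-enum T∩Z)))
        where
        _~_ : Rel Carrier _
        x ~ y = x \\ y ∈ Subset.pred T
        quotient-central : ∀ {x y} → x ∈ Subset.pred S∩Z → y ∈ Subset.pred S∩Z → x \\ y ∈ Central
        quotient-central {x} {y} (_ , x-c) (_ , y-c) = Quotient.Central-resp (≈⇒≈ₙ (sym (\\≈⁻¹∙ x y)))
          (Quotient.Central-∙ (Quotient.Central-⁻¹ x-c) y-c)
        ~-sym : ∀ {x y} → x ∈ Subset.pred S∩Z → y ∈ Subset.pred S∩Z → x ~ y → y ~ x
        ~-sym {x} {y} _ _ x~y = Subset.resp T (begin
          (x \\ y) ⁻¹         ≈⟨ ⁻¹-cong (\\≈⁻¹∙ x y) ⟩
          (x ⁻¹ ∙ y) ⁻¹       ≈⟨ ⁻¹-anti _ _ ⟩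
          y ⁻¹ ∙ (x ⁻¹) ⁻¹    ≈⟨ ∙-congˡ (⁻¹-involutive x) ⟩
          y ⁻¹ ∙ x            ≈⟨ \\≈⁻¹∙ y x ⟨
          y \\ x              ∎) (T′.⁻¹-closed x~y)
        ~-trans : ∀ {x y z} → x ∈ Subset.pred S∩Z → y ∈ Subset.pred S∩Z → z ∈ Subset.pred S∩Z →
                  x ~ y → y ~ z → x ~ z
        ~-trans {x} {y} {z} x∈ y∈ _ x~y y~z = Subset.resp T
          (\\-congˡ (trans (∙-congʳ (leftDividesˡ x y)) (leftDividesˡ y z)))
          (coset-∙ (proj₁ x∈) (x~y , quotient-central x∈ y∈) y~z)
        enumeration : ∃ (Enum (Subset.pred S∩Z) _~_)
        enumeration = class-enum S∩Z (λ x y → Subset.dec T (x \\ y))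
          (λ {x} x≈y → Subset.resp T (trans (sym (x\\x≈ε x)) (\\-congˡ x≈y)) T.ε-closed) ~-sym ~-trans
          where open LoopProperties Q using (x\\x≈ε)
        m : ℕ
        m = proj₁ enumeration
        E : Enum (Subset.pred S∩Z) _~_ m
        E = proj₂ enumeration

      index-divides : ¬ ¬ (SizeT.index ∣ SizeS.index)
      index-divides k = SizeT.index-power λ { (i , t≡) → SizeS.index-power λ { (j , s≡) →
        k (≡.subst₂ _∣_ (≡.sym t≡) (≡.sym s≡) (^-≤⇒∣ 3 i j (≡.subst₂ _≤_ t≡ s≡
          (enum-≤ Quotient.≋-sym Quotient.≋-trans T⊆S (proj₂ SizeT.reduced) (proj₂ SizeS.reduced))))) } }

      lagrange : card fin T ∣ card fin S
      lagrange = decidable-stable (card fin T ∣? card fin S) λ k → index-divides λ index∣ →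
        k (≡.subst₂ _∣_ (≡.sym SizeT.card-decompose) (≡.sym SizeS.card-decompose)
          (*-pres-∣ index∣ central-card))

-- Intersections of cosets

module Cosets {c ℓ : Level} (Q : Loop c ℓ) where
  open Loop Q
  open LoopTheory Q

  module Intersection {p : Level} (fin : Finite) (moufang : IsMoufang) (leftAut : IsLeftAutomorphic)
    {S : Subset p} (S≤ : IsSubloop S) {x y : Carrier} (meet : Nonempty (x ⋆ S ∩ y ⋆ S)) where
    open MoufangLoop Q moufang
    open LeftAutomorphic leftAut
    open QuasigroupProperties quasigroup using (cancelˡ; y≈x\\z)
    open IsSubloop S≤
    open Subset S renaming (pred to inS)
    open Lagrange Q
    open FiniteLoop fin

    z : Carrier
    z = proj₁ meet

    record Through (x : Carrier) : Set (c ⊔ ℓ ⊔ p) where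
      field
        shift : Carrier
        inS-shift : inS shift
        factor : z ∙ shift ≈ x

    through : ∀ {x} → Subset.pred (x ⋆ S) z → Through x
    through {x} (s , s∈ , z≈xs) = record
      { shift = s ⁻¹
      ; inS-shift = \\-closed s∈ ε-closed
      ; factor = trans (∙-congʳ z≈xs) (⁻¹-cancelʳ s x) }

    -- γ carries z⁻¹(xS) onto S.
    module Translate {x} (t : Through x) where
      open Through t renaming (shift to u; inS-shift to u∈)

      γ γ⁻ : Carrier → Carrier
      γ = ⟦inner⟧ z u
      γ⁻ = Inverse.from (inner z u)

      module γ = Inner z u

      γγ⁻ : ∀ a → γ (γ⁻ a) ≈ a
      γγ⁻ = Inverse.strictlyInverseˡ (inner z u)

      γ⁻γ : ∀ a → γ⁻ (γ a) ≈ a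
      γ⁻γ = Inverse.strictlyInverseʳ (inner z u)

      γ-cong : ∀ {a b} → a ≈ b → γ a ≈ γ b
      γ-cong = Inverse.to-cong (inner z u)

      γ⁻-cong : ∀ {a b} → a ≈ b → γ⁻ a ≈ γ⁻ b
      γ⁻-cong = Inverse.from-cong (inner z u)

      -- As `x` is `z ∙ u`, the left quotient of `z ∙ a` by `x` is `γ` of the left quotient of `a`
      -- by `u`; and `γ` is an automorphism fixing `u`.
      quotient : ∀ a → x \\ (z ∙ a) ≈ u \\ γ a
      quotient a = begin
        x \\ (z ∙ a)                    ≈⟨ \\-cong factor (∙-congˡ (leftDividesˡ u a)) ⟨
        γ (u \\ a)                      ≈⟨ γ.\\-homo u a ⟩
        γ u \\ γ a                      ≈⟨ \\-congʳ (inner-fixes z u) ⟩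
        u \\ γ a                        ∎
        where open SetoidReasoning setoid

      to-coset : ∀ {a} → inS (γ a) → Subset.pred (x ⋆ S) (z ∙ a)
      to-coset {a} γa∈ = x \\ (z ∙ a) , resp (sym (quotient a)) (\\-closed u∈ γa∈) , sym (leftDividesˡ x _)

      from-coset : ∀ {a} → Subset.pred (x ⋆ S) (z ∙ a) → inS (γ a)
      from-coset {a} (s , s∈ , za≈xs) = resp
        (trans (∙-congˡ (trans (y≈x\\z x s _ (sym za≈xs)) (quotient a))) (leftDividesˡ u _))
        (∙-closed u∈ s∈)

    module Xγ = Translate (through (proj₁ (proj₂ meet)))
    module Yγ = Translate (through (proj₂ (proj₂ meet)))

    φ : Carrier → Carrier
    φ r = Yγ.γ (Xγ.γ⁻ r)

    φ-cong : ∀ {r r′} → r ≈ r′ → φ r ≈ φ r′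
    φ-cong r≈r′ = Yγ.γ-cong (Xγ.γ⁻-cong r≈r′)

    -- The image of `z⁻¹(xS ∩ yS)` under `Xγ.γ`: membership of `r` in `S` accounts for `xS`, that of
    -- `φ r` for `yS`.
    T : Subset p
    T = record
      { pred = λ r → inS r × inS (φ r)
      ; resp = λ r≈r′ (r∈ , φr∈) → resp r≈r′ r∈ , resp (φ-cong r≈r′) φr∈
      ; dec  = λ r → dec r ×-dec dec (φ r)
      }

    private
      -- Kept generic in the operation to serve multiplication and both divisions.
      γ⁻-homo : ∀ {_⊛_ : Carrier → Carrier → Carrier} →
                (∀ {a a′ b b′} → a ≈ a′ → b ≈ b′ → (a ⊛ b) ≈ (a′ ⊛ b′)) →
                (∀ a b → Xγ.γ (a ⊛ b) ≈ Xγ.γ a ⊛ Xγ.γ b) →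
                (∀ a b → Yγ.γ (a ⊛ b) ≈ Yγ.γ a ⊛ Yγ.γ b) →
                ∀ r s → φ r ⊛ φ s ≈ φ (r ⊛ s)
      γ⁻-homo {_⊛_} ⊛-cong x-homo y-homo r s = begin
        φ r ⊛ φ s                                    ≈⟨ y-homo _ _ ⟨
        Yγ.γ (Xγ.γ⁻ r ⊛ Xγ.γ⁻ s)                        ≈⟨ Yγ.γ-cong (Xγ.γ⁻γ _) ⟨
        φ (Xγ.γ (Xγ.γ⁻ r ⊛ Xγ.γ⁻ s))                    ≈⟨ φ-cong (x-homo _ _) ⟩
        φ (Xγ.γ (Xγ.γ⁻ r) ⊛ Xγ.γ (Xγ.γ⁻ s))              ≈⟨ φ-cong (⊛-cong (Xγ.γγ⁻ r) (Xγ.γγ⁻ s)) ⟩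
        φ (r ⊛ s)                                    ∎
        where open SetoidReasoning setoid

      φ-ε : ε ≈ φ ε
      φ-ε = trans (sym Yγ.γ.ε-homo) (Yγ.γ-cong (trans (sym (Xγ.γ⁻γ ε)) (Xγ.γ⁻-cong Xγ.γ.ε-homo)))

    T≤ : IsSubloop T
    T≤ = record
      { ε-closed  = ε-closed , resp φ-ε ε-closed
      ; ∙-closed  = λ (r∈ , φr∈) (s∈ , φs∈) →
          ∙-closed r∈ s∈ , resp (γ⁻-homo ∙-cong Xγ.γ.∙-homo Yγ.γ.∙-homo _ _) (∙-closed φr∈ φs∈)
      ; \\-closed = λ (r∈ , φr∈) (s∈ , φs∈) →
          \\-closed r∈ s∈ , resp (γ⁻-homo \\-cong Xγ.γ.\\-homo Yγ.γ.\\-homo _ _) (\\-closed φr∈ φs∈)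
      ; //-closed = λ (r∈ , φr∈) (s∈ , φs∈) →
          //-closed r∈ s∈ , resp (γ⁻-homo //-cong Xγ.γ.//-homo Yγ.γ.//-homo _ _) (//-closed φr∈ φs∈)
      }

    -- Left inner maps fix nuclear elements, hence so does `φ`.
    nuclear⊆T : ∀ {n} → Nuclear n → inS n → Subset.pred T n
    nuclear⊆T {n} n∈N n∈ = n∈ , resp (sym (begin
      φ n        ≈⟨ Yγ.γ-cong (Xγ.γ⁻-cong (inner-nuclear _ _ n∈N)) ⟨
      φ (Xγ.γ n)  ≈⟨ Yγ.γ-cong (Xγ.γ⁻γ n) ⟩
      Yγ.γ n      ≈⟨ inner-nuclear _ _ n∈N ⟩
      n          ∎)) n∈
      where open SetoidReasoning setoid

    intersection-enum : Enum (Subset.pred (x ⋆ S ∩ y ⋆ S)) _≈_ (card fin T)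
    intersection-enum = record
      { elem = λ i → z ∙ Xγ.γ⁻ (elem i)
      ; elem-∈ = λ i → let r∈ , φr∈ = elem-∈ i in
          Xγ.to-coset (resp (sym (Xγ.γγ⁻ _)) r∈) , Yγ.to-coset φr∈
      ; elem-injective = λ i j eq → elem-injective i j
          (trans (sym (Xγ.γγ⁻ _)) (trans (Xγ.γ-cong (cancelˡ z _ _ eq)) (Xγ.γγ⁻ _)))
      ; elem-surjective = λ {w} (w∈x , w∈y) →
          let a = z \\ w
              w≈za = sym (leftDividesˡ z w)
              in-x = Xγ.from-coset {a} (Subset.resp (x ⋆ S) w≈za w∈x)
              in-y = Yγ.from-coset {a} (Subset.resp (y ⋆ S) w≈za w∈y)
              i , eq = elem-surjective {Xγ.γ a} (in-x , resp (Yγ.γ-cong (sym (Xγ.γ⁻γ a))) in-y)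
          in i , trans w≈za (∙-congˡ (trans (sym (Xγ.γ⁻γ a)) (Xγ.γ⁻-cong eq)))
      }
      where open Enum (card-enum T)

    card-intersection : card fin (x ⋆ S ∩ y ⋆ S) ≡ card fin T
    card-intersection = enum-unique sym trans (card-enum (x ⋆ S ∩ y ⋆ S)) intersection-enum

    card-divides : card fin (x ⋆ S ∩ y ⋆ S) ∣ card fin S
    card-divides = ≡.subst (_∣ card fin S) (≡.sym card-intersection)
      (lagrange fin moufang leftAut S≤ T≤ proj₁ nuclear⊆T)

theorem6p8 : ∀ {c ℓ p : Level} (Q : Loop c ℓ) (let open Loop Q using (Carrier)) (let open LoopTheory Q) →
    (fin : Finite) → IsMoufang → IsLeftAutomorphic →
    (S : Subset p) → IsSubloop S →
    (x y : Carrier) → Nonempty (x ⋆ S ∩ y ⋆ S) →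
    (∃ λ (T : Subset p) → IsSubloop T × T ⊆ S × card fin (x ⋆ S ∩ y ⋆ S) ≡ card fin T)
    × (card fin (x ⋆ S ∩ y ⋆ S) ∣ card fin S)
theorem6p8 Q fin moufang leftAut S S≤ x y meet = (T , T≤ , proj₁ , card-intersection) , card-divides
  where open Cosets.Intersection Q fin moufang leftAut S≤ meet
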